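{- Let $q$ be a prime power and let $k>1$ and $n\geq k+5$ be integers. Let $\mathcal{L}$ be a Cameron-Liebler $k$-set in $\mathrm{AG}(n,q)$ with parameter $x$. Then $$x(x-1)\frac{q^{n-k-1}-1}{q-1}\equiv 0 \pmod{2(q+1)}.$$
   Context: A $k$-spread of the affine space $\mathrm{AG}(n,q)$ is a set of $k$-dimensional affine subspaces partitioning the point set of $\mathrm{AG}(n,q)$. A Cameron-Liebler $k$-set with parameter $x$ in $\mathrm{AG}(n,q)$ is a set $\mathcal{L}$ of $k$-dimensional subspaces of $\mathrm{AG}(n,q)$ such that $|\mathcal{L}\cap\mathcal{S}|=x$ for every $k$-spread $\mathcal{S}$ of $\mathrm{AG}(n,q)$. -}

module Defs where

open import Level using (0ℓ)
open import Algebra.Bundles using (CommutativeRing)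
open import Data.Nat as ℕ using (ℕ; zero; suc; _^_)
open import Data.Nat.Primality using (Prime)
open import Data.Fin using (Fin; zero; suc)
open import Data.Bool using (Bool; true; false)
open import Data.Product using (∃; _×_; _,_)
open import Relation.Nullary using (¬_)
open import Relation.Binary.PropositionalEquality using (_≡_)
open import Function using (_∘_)

IsPrimePower : ℕ → Set
IsPrimePower q = ∃ λ p → ∃ λ m → Prime p × q ≡ p ^ suc m

record FiniteField (q : ℕ) : Set₁ where
  field
    ring : CommutativeRing 0ℓ 0ℓ
  open CommutativeRing ring using (Carrier; _≈_; _*_; 0#; 1#)
  field
    1≉0       : ¬ (1# ≈ 0#)
    inverse   : ∀ a → ¬ (a ≈ 0#) → ∃ λ b → (a * b) ≈ 1#
    enum      : Fin q → Carrier
    enum-surj : ∀ a → ∃ λ i → enum i ≈ a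
    enum-inj  : ∀ i j → enum i ≈ enum j → i ≡ j

-- (q^m - 1)/(q - 1) = 1 + q + ... + q^(m-1)
gauss1 : ℕ → ℕ → ℕ
gauss1 q zero    = 0
gauss1 q (suc m) = q ^ m ℕ.+ gauss1 q m

countTrue : ∀ m → (Fin m → Bool) → ℕ
countTrue zero    f = 0
countTrue (suc m) f with f zero
... | true  = suc (countTrue m (f ∘ suc))
... | false = countTrue m (f ∘ suc)

module AG {q : ℕ} (F : FiniteField q) (n : ℕ) where
  open FiniteField F using (ring)
  open CommutativeRing ring using (Carrier; _≈_; _+_; _*_; 0#)

  Point : Set
  Point = Fin n → Carrier

  _≈ᵥ_ : Point → Point → Set
  x ≈ᵥ y = ∀ j → x j ≈ y j

  0ᵥ : Point
  0ᵥ j = 0#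

  _+ᵥ_ : Point → Point → Point
  (x +ᵥ y) j = x j + y j

  lincomb : ∀ {k} → (Fin k → Carrier) → (Fin k → Point) → Point
  lincomb {zero}  a v j = 0#
  lincomb {suc k} a v j = (a zero * v zero j) + lincomb (a ∘ suc) (v ∘ suc) j

  record Sub (k : ℕ) : Set where
    field
      base  : Point
      dir   : Fin k → Point
      indep : ∀ (a : Fin k → Carrier) → lincomb a dir ≈ᵥ 0ᵥ → ∀ i → a i ≈ 0#

  _∈S_ : ∀ {k} → Point → Sub k → Set
  x ∈S U = ∃ λ (a : Fin _ → Carrier) → x ≈ᵥ (Sub.base U +ᵥ lincomb a (Sub.dir U))

  SameSub : ∀ {k} → Sub k → Sub k → Set
  SameSub U V = ∀ x → ((x ∈S U → x ∈S V) × (x ∈S V → x ∈S U))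

  IsSpread : ∀ {k m} → (Fin m → Sub k) → Set
  IsSpread {k} {m} S =
    ∀ x → (∃ λ i → x ∈S S i) × (∀ i j → x ∈S S i → x ∈S S j → i ≡ j)

  -- a set of k-subspaces, given by its (Bool-valued) characteristic function,
  -- which must be well defined on subspaces (independent of representation)
  WellDefined : ∀ {k} → (Sub k → Bool) → Set
  WellDefined {k} L = ∀ U V → SameSub U V → L U ≡ L V

  IsCameronLiebler : ∀ {k} → (Sub k → Bool) → ℕ → Set
  IsCameronLiebler {k} L x =
    ∀ m (S : Fin m → Sub k) → IsSpread S → countTrue m (L ∘ S) ≡ x

{-# OPTIONS --safe #-}

-- Cylinders over the k-subspaces of AG(n,q) are (k+1)-subspaces of AG(n+1,q) and carry spreads to
-- spreads, so it suffices to treat a set L of lines in AG(N,q) with N = n - k + 1.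
--
-- For N even, q + 1 divides the Gaussian number, and x (x - 1) is even. For N odd, let f be the
-- characteristic function of L. Comparing spreads that differ in a single plane shows that, in each
-- plane, all parallel classes contain equally many lines of L. Hence the number of lines of L
-- through a point p, minus x, sums to G f(ℓ) over every line ℓ, where G = q + ... + q^(N-1), so f is
-- the line sum of a rational weight. Counting in a plane through p shows that q times the weight is
-- an integer u(p). Double counting the sum of f(ℓ)² = f(ℓ) over all lines ℓ then gives
-- q² x (x - 1) = G Σ u(p) (q - u(p)), where q (q + 1) divides G, and every summand is even if q is odd.

module Submission where

open import Defs
open import Level using (0ℓ)
open import Algebra.Bundles using (CommutativeRing; RawRing; AbelianGroup)
open import Algebra.Structures using (IsCommutativeRing; IsAbelianGroup)
open import Algebra.Morphism.Structures using (IsRingMonomorphism)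
import Algebra.Morphism.RingMonomorphism as RingMonomorphism
import Algebra.Properties.Ring as RingProperties
import Algebra.Properties.AbelianGroup as AbelianGroupProperties
open import Data.Nat as ℕ using (ℕ; zero; suc)
import Data.Nat.Properties as ℕP
import Data.Nat.Divisibility as ℕ∣
import Data.Nat.Tactic.RingSolver as ℕSolver
open import Data.Nat.Coprimality as Coprimality using (Coprime)
open import Data.Integer as ℤ using (ℤ; _+_; _*_; -_; _-_; 0ℤ; 1ℤ) renaming (+_ to pos)
import Data.Integer.Properties as ℤP
open import Data.Integer.Tactic.RingSolver using (solve-∀)
open import Data.Fin using (Fin; zero; suc)
import Data.Fin.Properties as FinP
open import Data.Bool using (Bool; true; false; if_then_else_)
open import Data.Empty using (⊥)
open import Data.Product using (∃; ∃₂; _×_; _,_; proj₁; proj₂)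
open import Data.Sum using (_⊎_; inj₁; inj₂)
open import Data.List using (List; []; _∷_; _++_; map; length; filter; lookup; allFin; cartesianProductWith)
open import Data.List.Properties using (length-tabulate)
open import Data.List.Relation.Unary.Any as Any using (here; there)
import Data.List.Relation.Unary.Any.Properties as AnyP
open import Data.List.Relation.Unary.All as All using (All; []; _∷_)
open import Data.List.Relation.Unary.AllPairs using ([]; _∷_)
open import Data.List.Relation.Unary.Unique.Propositional using (Unique)
import Data.List.Relation.Unary.Unique.Propositional.Properties as UniqueP
open import Data.List.Membership.Propositional using (_∈_)
import Data.List.Membership.Propositional.Properties as ∈P
open import Data.Vec as Vec using (Vec; []; _∷_)
import Data.Vec.Properties as VecP
open import Data.Vec.Functional using () renaming (_∷_ to _◂_)
open import Function using (_∘_; id)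
open import Relation.Binary using (DecidableEquality)
open import Relation.Binary.PropositionalEquality hiding ([_])
open import Relation.Nullary using (¬_; Dec; yes; no; does; contradiction)
open import Relation.Unary using (Pred; Decidable)

open ≡-Reasoning

module ℤ+ = AbelianGroupProperties ℤP.+-0-abelianGroup

private variable
  A B C : Set

*-swap : ∀ i j k → i * (j * k) ≡ j * (i * k)
*-swap = solve-∀

-- Finite sums

∑ : List A → (A → ℤ) → ℤ
∑ []       h = 0ℤ
∑ (x ∷ xs) h = h x + ∑ xs h

∑-cong : {h k : A → ℤ} (xs : List A) → (∀ x → h x ≡ k x) → ∑ xs h ≡ ∑ xs k
∑-cong []       e = refl
∑-cong (x ∷ xs) e = cong₂ _+_ (e x) (∑-cong xs e)

∑-zero : (xs : List A) → ∑ xs (λ _ → 0ℤ) ≡ 0ℤ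
∑-zero []       = refl
∑-zero (x ∷ xs) = trans (ℤP.+-identityˡ _) (∑-zero xs)

∑-distrib-+ : (h k : A → ℤ) (xs : List A) → ∑ xs (λ x → h x + k x) ≡ ∑ xs h + ∑ xs k
∑-distrib-+ h k []       = refl
∑-distrib-+ h k (x ∷ xs) = trans (cong (λ s → h x + k x + s) (∑-distrib-+ h k xs)) (swap (h x) (k x) _ _)
  where
  swap : ∀ a b c d → a + b + (c + d) ≡ a + c + (b + d)
  swap = solve-∀

∑-distribˡ-* : (c : ℤ) (h : A → ℤ) (xs : List A) → ∑ xs (λ x → c * h x) ≡ c * ∑ xs h
∑-distribˡ-* c h []       = sym (ℤP.*-zeroʳ c)
∑-distribˡ-* c h (x ∷ xs) =
  trans (cong (λ s → c * h x + s) (∑-distribˡ-* c h xs)) (sym (ℤP.*-distribˡ-+ c (h x) _))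

∑-distribʳ-* : (c : ℤ) (h : A → ℤ) (xs : List A) → ∑ xs (λ x → h x * c) ≡ ∑ xs h * c
∑-distribʳ-* c h xs = begin
  ∑ xs (λ x → h x * c)  ≡⟨ ∑-cong xs (λ x → ℤP.*-comm (h x) c) ⟩
  ∑ xs (λ x → c * h x)  ≡⟨ ∑-distribˡ-* c h xs ⟩
  c * ∑ xs h            ≡⟨ ℤP.*-comm c _ ⟩
  ∑ xs h * c            ∎

∑-distrib-- : (h k : A → ℤ) (xs : List A) → ∑ xs (λ x → h x - k x) ≡ ∑ xs h - ∑ xs k
∑-distrib-- h k []       = refl
∑-distrib-- h k (x ∷ xs) = trans (cong (λ s → h x - k x + s) (∑-distrib-- h k xs)) (swap (h x) (k x) _ _)
  where
  swap : ∀ a b c d → a - b + (c - d) ≡ a + c - (b + d)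
  swap = solve-∀

∑-const : (c : ℤ) (xs : List A) → ∑ xs (λ _ → c) ≡ pos (length xs) * c
∑-const c []       = refl
∑-const c (x ∷ xs) = trans (cong (c +_) (∑-const c xs)) (sym (ℤP.suc-* (pos (length xs)) c))

∑-comm : (h : A → B → ℤ) (xs : List A) (ys : List B) →
  ∑ xs (λ x → ∑ ys (h x)) ≡ ∑ ys (λ y → ∑ xs (λ x → h x y))
∑-comm h []       ys = sym (∑-zero ys)
∑-comm h (x ∷ xs) ys = trans (cong (∑ ys (h x) +_) (∑-comm h xs ys)) (sym (∑-distrib-+ (h x) _ ys))

∑-++ : (h : A → ℤ) (xs ys : List A) → ∑ (xs ++ ys) h ≡ ∑ xs h + ∑ ys h
∑-++ h []       ys = sym (ℤP.+-identityˡ _)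
∑-++ h (x ∷ xs) ys = trans (cong (h x +_) (∑-++ h xs ys)) (sym (ℤP.+-assoc (h x) _ _))

∑-map : (h : B → ℤ) (g : A → B) (xs : List A) → ∑ (map g xs) h ≡ ∑ xs (h ∘ g)
∑-map h g []       = refl
∑-map h g (x ∷ xs) = cong (h (g x) +_) (∑-map h g xs)

∑-cartesianProductWith : (h : C → ℤ) (g : A → B → C) (xs : List A) (ys : List B) →
  ∑ (cartesianProductWith g xs ys) h ≡ ∑ xs (λ x → ∑ ys (λ y → h (g x y)))
∑-cartesianProductWith h g []       ys = refl
∑-cartesianProductWith h g (x ∷ xs) ys =
  trans (∑-++ h (map (g x) ys) _) (cong₂ _+_ (∑-map h (g x) ys) (∑-cartesianProductWith h g xs ys))

-- Iverson brackets and counting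

[_] : {P : Set} → Dec P → ℤ
[ d ] = if does d then 1ℤ else 0ℤ

[]-yes : {P : Set} (d : Dec P) → P → [ d ] ≡ 1ℤ
[]-yes (yes _)  p = refl
[]-yes (no ¬p)  p = contradiction p ¬p

[]-no : {P : Set} (d : Dec P) → ¬ P → [ d ] ≡ 0ℤ
[]-no (yes p)  ¬p = contradiction p ¬p
[]-no (no _)   ¬p = refl

[]-⇔ : {P Q : Set} (d : Dec P) (e : Dec Q) → (P → Q) → (Q → P) → [ d ] ≡ [ e ]
[]-⇔ (yes p) e f g = sym ([]-yes e (f p))
[]-⇔ (no ¬p) e f g = sym ([]-no e (¬p ∘ g))

∑-filter : {P : Pred A 0ℓ} (P? : Decidable P) (h : A → ℤ) (xs : List A) →
  ∑ (filter P? xs) h ≡ ∑ xs (λ x → [ P? x ] * h x)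
∑-filter P? h []       = refl
∑-filter P? h (x ∷ xs) with P? x
... | yes _ = cong₂ _+_ (sym (ℤP.*-identityˡ (h x))) (∑-filter P? h xs)
... | no  _ = trans (∑-filter P? h xs) (sym (ℤP.+-identityˡ _))

bit : Bool → ℤ
bit true  = 1ℤ
bit false = 0ℤ

bit-idem : ∀ b → bit b * bit b ≡ bit b
bit-idem true  = refl
bit-idem false = refl

-- Turns the count in the Cameron-Liebler condition into an integer sum when a spread is given by
-- the entries of a list.
countTrue-lookup : (f : A → Bool) (xs : List A) →
  pos (countTrue (length xs) (f ∘ lookup xs)) ≡ ∑ xs (bit ∘ f)
countTrue-lookup f []       = refl
countTrue-lookup f (x ∷ xs) with f x
... | true  = cong (1ℤ +_) (countTrue-lookup f xs)
... | false = trans (countTrue-lookup f xs) (sym (ℤP.+-identityˡ _))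

lookup-injective : {xs : List A} → Unique xs → ∀ i j → lookup xs i ≡ lookup xs j → i ≡ j
lookup-injective (x∉ ∷ u) zero    zero    e = refl
lookup-injective (x∉ ∷ u) zero    (suc j) e = contradiction e (All.lookup x∉ (∈P.∈-lookup j))
lookup-injective (x∉ ∷ u) (suc i) zero    e = contradiction (sym e) (All.lookup x∉ (∈P.∈-lookup i))
lookup-injective (x∉ ∷ u) (suc i) (suc j) e = cong suc (lookup-injective u i j e)

-- Summation over finite types

record Finite (A : Set) : Set where
  field
    elems    : List A
    unique   : Unique elems
    complete : ∀ a → a ∈ elems
    _≟_      : DecidableEquality A

module FiniteSum (fin : Finite A) where
  open Finite fin

  private
    δ-absent : (h : A → ℤ) (a : A) {xs : List A} → All (a ≢_) xs →
      ∑ xs (λ x → [ x ≟ a ] * h x) ≡ 0ℤ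
    δ-absent h a []           = refl
    δ-absent h a (_∷_ {x = x} a≢x ne) =
      cong₂ _+_ (cong (_* h x) ([]-no (x ≟ a) (a≢x ∘ sym))) (δ-absent h a ne)

    δ-present : (h : A → ℤ) (a : A) {xs : List A} → Unique xs → a ∈ xs →
      ∑ xs (λ x → [ x ≟ a ] * h x) ≡ h a
    δ-present h a {xs = .a ∷ xs} (a∉ ∷ u) (here refl) = begin
      [ a ≟ a ] * h a + ∑ xs _  ≡⟨ cong₂ (λ s t → s * h a + t) ([]-yes (a ≟ a) refl) (δ-absent h a a∉) ⟩
      1ℤ * h a + 0ℤ             ≡⟨ ℤP.+-identityʳ _ ⟩
      1ℤ * h a                  ≡⟨ ℤP.*-identityˡ _ ⟩
      h a                       ∎
    δ-present h a {xs = x ∷ xs} (x∉ ∷ u) (there a∈) = begin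
      [ x ≟ a ] * h x + ∑ xs _  ≡⟨ cong₂ (λ s t → s * h x + t) ([]-no (x ≟ a) (All.lookup x∉ a∈)) (δ-present h a u a∈) ⟩
      0ℤ * h x + h a            ≡⟨ ℤP.+-identityˡ _ ⟩
      h a                       ∎

  ∑-δ : (h : A → ℤ) (a : A) → ∑ elems (λ x → [ x ≟ a ] * h x) ≡ h a
  ∑-δ h a = δ-present h a unique (complete a)

  ∑-δ-1 : (a : A) → ∑ elems (λ x → [ x ≟ a ]) ≡ 1ℤ
  ∑-δ-1 a = trans (∑-cong elems (λ x → sym (ℤP.*-identityʳ _))) (∑-δ (λ _ → 1ℤ) a)

  -- Each `h (π x)` is expanded as a delta sum over `y`. After interchanging the sums, `h y` is
  -- weighted by the size of the fibre of `π` over `y`, which consists of `π⁻¹ y` alone.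
  ∑-reindex : (π π⁻¹ : A → A) → (∀ x → π (π⁻¹ x) ≡ x) → (∀ x → π⁻¹ (π x) ≡ x) →
    (h : A → ℤ) → ∑ elems (h ∘ π) ≡ ∑ elems h
  ∑-reindex π π⁻¹ invˡ invʳ h = begin
    ∑ elems (λ x → h (π x))
      ≡⟨ ∑-cong elems (λ x → sym (∑-δ h (π x))) ⟩
    ∑ elems (λ x → ∑ elems (λ y → [ y ≟ π x ] * h y))
      ≡⟨ ∑-comm _ elems elems ⟩
    ∑ elems (λ y → ∑ elems (λ x → [ y ≟ π x ] * h y))
      ≡⟨ ∑-cong elems (λ y → trans (∑-distribʳ-* (h y) _ elems) (cong (_* h y) (fibre y))) ⟩
    ∑ elems (λ y → 1ℤ * h y)
      ≡⟨ ∑-cong elems (λ y → ℤP.*-identityˡ (h y)) ⟩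
    ∑ elems h ∎
    where
    fibre : ∀ y → ∑ elems (λ x → [ y ≟ π x ]) ≡ 1ℤ
    fibre y = trans
      (∑-cong elems (λ x → []-⇔ (y ≟ π x) (x ≟ π⁻¹ y)
        (λ e → trans (sym (invʳ x)) (cong π⁻¹ (sym e)))
        (λ e → trans (sym (invˡ y)) (cong π (sym e)))))
      (∑-δ-1 (π⁻¹ y))

  -- Adding to each sum the value of the other function at `a` makes the two summands agree
  -- everywhere.
  ∑-exchange-at : (a : A) (h k : A → ℤ) → (∀ x → x ≢ a → h x ≡ k x) →
    ∑ elems h + k a ≡ ∑ elems k + h a
  ∑-exchange-at a h k agree = begin
    ∑ elems h + k a
      ≡⟨ cong (∑ elems h +_) (sym (∑-δ k a)) ⟩
    ∑ elems h + ∑ elems (λ x → [ x ≟ a ] * k x)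
      ≡⟨ sym (∑-distrib-+ h _ elems) ⟩
    ∑ elems (λ x → h x + [ x ≟ a ] * k x)
      ≡⟨ ∑-cong elems pointwise ⟩
    ∑ elems (λ x → k x + [ x ≟ a ] * h x)
      ≡⟨ ∑-distrib-+ k _ elems ⟩
    ∑ elems k + ∑ elems (λ x → [ x ≟ a ] * h x)
      ≡⟨ cong (∑ elems k +_) (∑-δ h a) ⟩
    ∑ elems k + h a ∎
    where
    pointwise : ∀ x → h x + [ x ≟ a ] * k x ≡ k x + [ x ≟ a ] * h x
    pointwise x with x ≟ a
    ... | yes _  = flip (h x) (k x)
      where
      flip : ∀ s t → s + 1ℤ * t ≡ t + 1ℤ * s
      flip = solve-∀
    ... | no x≢a = cong (_+ 0ℤ) (agree x x≢a)

-- Vectors and directions over a finite field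

module Coordinates {q : ℕ} (F : FiniteField q) where
  private variable
    n : ℕ

  open FiniteField F
  private module R = CommutativeRing ring

  -- Scalars as indices, with propositional equality

  K : Set
  K = Fin q

  index : R.Carrier → K
  index a = proj₁ (enum-surj a)

  enum-index : ∀ a → enum (index a) R.≈ a
  enum-index a = proj₂ (enum-surj a)

  infixl 6 _⊕_
  infixl 7 _⊗_
  infix  8 ⊖_

  _⊕_ _⊗_ : K → K → K
  s ⊕ t = index (enum s R.+ enum t)
  s ⊗ t = index (enum s R.* enum t)

  ⊖_ : K → K
  ⊖ t = index (R.- enum t)

  𝟘 𝟙 : K
  𝟘 = index R.0#
  𝟙 = index R.1#

  private
    K-rawRing : RawRing 0ℓ 0ℓ
    K-rawRing = record
      { Carrier = K ; _≈_ = _≡_ ; _+_ = _⊕_ ; _*_ = _⊗_ ; -_ = ⊖_ ; 0# = 𝟘 ; 1# = 𝟙 }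

    -- Every operation on indices is `index` of the operation in the field, so each homomorphism law
    -- is an instance of `enum-index`. Injectivity pulls the ring axioms back to `_≡_`.
    enum-monomorphism : IsRingMonomorphism K-rawRing R.rawRing enum
    enum-monomorphism = record
      { isRingHomomorphism = record
        { isSemiringHomomorphism = record
          { isNearSemiringHomomorphism = record
            { +-isMonoidHomomorphism = record
              { isMagmaHomomorphism = record
                { isRelHomomorphism = record { cong = λ e → R.reflexive (cong enum e) }
                ; homo = λ s t → enum-index _ }
              ; ε-homo = enum-index _ }
            ; *-homo = λ s t → enum-index _ }
          ; 1#-homo = enum-index _ }
        ; -‿homo = λ t → enum-index _ }
      ; injective = enum-inj _ _ }

  K-isCommutativeRing : IsCommutativeRing _≡_ _⊕_ _⊗_ ⊖_ 𝟘 𝟙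
  K-isCommutativeRing = RingMonomorphism.isCommutativeRing enum-monomorphism R.isCommutativeRing

  K-commutativeRing : CommutativeRing 0ℓ 0ℓ
  K-commutativeRing = record { isCommutativeRing = K-isCommutativeRing }

  module 𝕂 = CommutativeRing K-commutativeRing
  module 𝕂P = RingProperties 𝕂.ring

  reciprocal : ∀ t → t ≢ 𝟘 → ∃ λ s → t ⊗ s ≡ 𝟙
  reciprocal t t≢𝟘 = index (proj₁ inv) , enum-inj _ _
    (R.trans (enum-index _) (R.trans (R.*-congˡ (enum-index _)) (R.trans (proj₂ inv) (R.sym (enum-index _)))))
    where
    inv = inverse (enum t) (λ e → t≢𝟘 (enum-inj _ _ (R.trans e (R.sym (enum-index _)))))

  V : ℕ → Set
  V = Vec K

  infixl 6 _⊞_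
  infixr 7 _·_
  infix  8 ⊟_

  _⊞_ : V n → V n → V n
  _⊞_ = Vec.zipWith _⊕_

  ⊟_ : V n → V n
  ⊟_ = Vec.map ⊖_

  𝟎 : V n
  𝟎 = Vec.replicate _ 𝟘

  _·_ : K → V n → V n
  t · v = Vec.map (t ⊗_) v

  V-isAbelianGroup : ∀ n → IsAbelianGroup _≡_ (_⊞_ {n}) 𝟎 ⊟_
  V-isAbelianGroup n = record
    { isGroup = record
      { isMonoid = record
        { isSemigroup = record
          { isMagma = isMagma _⊞_
          ; assoc = VecP.zipWith-assoc 𝕂.+-assoc }
        ; identity = VecP.zipWith-identityˡ 𝕂.+-identityˡ , VecP.zipWith-identityʳ 𝕂.+-identityʳ }
      ; inverse = VecP.zipWith-inverseˡ 𝕂.-‿inverseˡ , VecP.zipWith-inverseʳ 𝕂.-‿inverseʳ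
      ; ⁻¹-cong = cong ⊟_ }
    ; comm = VecP.zipWith-comm 𝕂.+-comm }

  V-abelianGroup : ℕ → AbelianGroup 0ℓ 0ℓ
  V-abelianGroup n = record { isAbelianGroup = V-isAbelianGroup n }

  module 𝕍 {n : ℕ} = AbelianGroup (V-abelianGroup n)
  module 𝕍P {n : ℕ} = AbelianGroupProperties (V-abelianGroup n)

  ·-distribʳ : ∀ s t (v : V n) → (s ⊕ t) · v ≡ s · v ⊞ t · v
  ·-distribʳ s t []      = refl
  ·-distribʳ s t (x ∷ v) = cong₂ _∷_ (𝕂.distribʳ x s t) (·-distribʳ s t v)

  ·-assoc : ∀ s t (v : V n) → (s ⊗ t) · v ≡ s · t · v
  ·-assoc s t []      = refl
  ·-assoc s t (x ∷ v) = cong₂ _∷_ (𝕂.*-assoc s t x) (·-assoc s t v)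

  ·-identity : (v : V n) → 𝟙 · v ≡ v
  ·-identity []      = refl
  ·-identity (x ∷ v) = cong₂ _∷_ (𝕂.*-identityˡ x) (·-identity v)

  ·-zeroˡ : (v : V n) → 𝟘 · v ≡ 𝟎
  ·-zeroˡ []      = refl
  ·-zeroˡ (x ∷ v) = cong₂ _∷_ (𝕂.zeroˡ x) (·-zeroˡ v)

  ·-zeroʳ : ∀ t → t · 𝟎 {n} ≡ 𝟎
  ·-zeroʳ {zero}  t = refl
  ·-zeroʳ {suc n} t = cong₂ _∷_ (𝕂.zeroʳ t) (·-zeroʳ t)

  ⊞-·-merge : ∀ (v : V n) s t w → v ⊞ s · w ⊞ t · w ≡ v ⊞ (s ⊕ t) · w
  ⊞-·-merge v s t w = trans (𝕍.assoc v _ _) (cong (v ⊞_) (sym (·-distribʳ s t w)))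

  ⊞-·-cancelʳ : ∀ (v : V n) t w → v ⊞ (⊖ t) · w ⊞ t · w ≡ v
  ⊞-·-cancelʳ v t w = begin
    v ⊞ (⊖ t) · w ⊞ t · w ≡⟨ ⊞-·-merge v (⊖ t) t w ⟩
    v ⊞ (⊖ t ⊕ t) · w     ≡⟨ cong (λ s → v ⊞ s · w) (𝕂.-‿inverseˡ t) ⟩
    v ⊞ 𝟘 · w             ≡⟨ cong (v ⊞_) (·-zeroˡ w) ⟩
    v ⊞ 𝟎                 ≡⟨ 𝕍.identityʳ v ⟩
    v                     ∎

  ⊞-·-cancelˡ : ∀ (v : V n) t w → v ⊞ t · w ⊞ (⊖ t) · w ≡ v
  ⊞-·-cancelˡ v t w = begin
    v ⊞ t · w ⊞ (⊖ t) · w ≡⟨ ⊞-·-merge v t (⊖ t) w ⟩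
    v ⊞ (t ⊕ ⊖ t) · w     ≡⟨ cong (λ s → v ⊞ s · w) (𝕂.-‿inverseʳ t) ⟩
    v ⊞ 𝟘 · w             ≡⟨ cong (v ⊞_) (·-zeroˡ w) ⟩
    v ⊞ 𝟎                 ≡⟨ 𝕍.identityʳ v ⟩
    v                     ∎

  ⊞-swap : ∀ (u v w : V n) → u ⊞ v ⊞ w ≡ u ⊞ w ⊞ v
  ⊞-swap u v w = trans (𝕍.assoc u v w) (trans (cong (u ⊞_) (𝕍.comm v w)) (sym (𝕍.assoc u w v)))

  -- A direction is a point at infinity, represented by its vector with first nonzero entry 1.
  Dir : ℕ → Set
  Dir zero    = ⊥
  Dir (suc n) = V n ⊎ Dir n

  vec : Dir n → V n
  vec {suc n} (inj₁ v) = 𝟙 ∷ v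
  vec {suc n} (inj₂ d) = 𝟘 ∷ vec d

  pivot : Dir n → Fin n
  pivot {suc n} (inj₁ v) = zero
  pivot {suc n} (inj₂ d) = suc (pivot d)

  -- A parameter along each line with direction `d`: since the pivot entry of `vec d` is 1, adding
  -- `t · vec d` raises it by `t`.
  coord : Dir n → V n → K
  coord d v = Vec.lookup v (pivot d)

  coord-vec : (d : Dir n) → coord d (vec d) ≡ 𝟙
  coord-vec {suc n} (inj₁ v) = refl
  coord-vec {suc n} (inj₂ d) = coord-vec d

  coord-⊞-·vec : (d : Dir n) (v : V n) (t : K) → coord d (v ⊞ t · vec d) ≡ coord d v ⊕ t
  coord-⊞-·vec d v t = begin
    coord d (v ⊞ t · vec d)              ≡⟨ VecP.lookup-zipWith _⊕_ (pivot d) v _ ⟩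
    coord d v ⊕ coord d (t · vec d)      ≡⟨ cong (coord d v ⊕_) (VecP.lookup-map (pivot d) (t ⊗_) (vec d)) ⟩
    coord d v ⊕ t ⊗ coord d (vec d)      ≡⟨ cong (λ s → coord d v ⊕ t ⊗ s) (coord-vec d) ⟩
    coord d v ⊕ t ⊗ 𝟙                    ≡⟨ cong (coord d v ⊕_) (𝕂.*-identityʳ t) ⟩
    coord d v ⊕ t                        ∎

  -- Sums over scalars, vectors and directions

  K-finite : Finite K
  K-finite = record
    { elems = allFin q ; unique = UniqueP.allFin⁺ q ; complete = ∈P.∈-allFin ; _≟_ = FinP._≟_ }

  vectors : ∀ n → List (V n)
  vectors zero    = [] ∷ []
  vectors (suc n) = cartesianProductWith _∷_ (allFin q) (vectors n)

  vectors-unique : ∀ n → Unique (vectors n)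
  vectors-unique zero    = [] ∷ []
  vectors-unique (suc n) =
    UniqueP.cartesianProductWith⁺ _∷_ VecP.∷-injective (UniqueP.allFin⁺ q) (vectors-unique n)

  vectors-complete : (v : V n) → v ∈ vectors n
  vectors-complete []      = here refl
  vectors-complete (x ∷ v) = ∈P.∈-cartesianProductWith⁺ _∷_ (∈P.∈-allFin x) (vectors-complete v)

  V-finite : ∀ n → Finite (V n)
  V-finite n = record
    { elems = vectors n ; unique = vectors-unique n ; complete = vectors-complete
    ; _≟_ = VecP.≡-dec FinP._≟_ }

  directions : ∀ n → List (Dir n)
  directions zero    = []
  directions (suc n) = map inj₁ (vectors n) ++ map inj₂ (directions n)

  ΣK : (K → ℤ) → ℤ
  ΣK = ∑ (allFin q)

  ΣV : (V n → ℤ) → ℤ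
  ΣV = ∑ (vectors _)

  ΣD : (Dir n → ℤ) → ℤ
  ΣD = ∑ (directions _)

  module ΣKP = FiniteSum K-finite
  module ΣVP {n : ℕ} = FiniteSum (V-finite n)

  ΣK-const : ∀ c → ΣK (λ _ → c) ≡ pos q * c
  ΣK-const c = trans (∑-const c (allFin q)) (cong (λ l → pos l * c) (length-tabulate {n = q} id))

  ΣV-suc : (h : V (suc n) → ℤ) → ΣV h ≡ ΣK (λ t → ΣV (λ v → h (t ∷ v)))
  ΣV-suc h = ∑-cartesianProductWith h _∷_ (allFin q) (vectors _)

  ΣD-suc : (h : Dir (suc n) → ℤ) → ΣD h ≡ ΣV (h ∘ inj₁) + ΣD (h ∘ inj₂)
  ΣD-suc {n} h = trans (∑-++ h (map inj₁ (vectors n)) _)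
    (cong₂ _+_ (∑-map h inj₁ (vectors n)) (∑-map h inj₂ (directions n)))

  ΣV-const : ∀ n c → ΣV {n} (λ _ → c) ≡ pos (q ℕ.^ n) * c
  ΣV-const zero    c = trans (ℤP.+-identityʳ c) (sym (ℤP.*-identityˡ c))
  ΣV-const (suc n) c = begin
    ΣV {suc n} (λ _ → c)               ≡⟨ ΣV-suc {n} _ ⟩
    ΣK (λ _ → ΣV {n} (λ _ → c))        ≡⟨ ΣK-const _ ⟩
    pos q * ΣV {n} (λ _ → c)           ≡⟨ cong (pos q *_) (ΣV-const n c) ⟩
    pos q * (pos (q ℕ.^ n) * c)        ≡⟨ sym (ℤP.*-assoc (pos q) _ c) ⟩
    pos q * pos (q ℕ.^ n) * c          ≡⟨ cong (_* c) (sym (ℤP.pos-* q (q ℕ.^ n))) ⟩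
    pos (q ℕ.^ suc n) * c              ∎

  ΣD-const : ∀ n c → ΣD {n} (λ _ → c) ≡ pos (gauss1 q n) * c
  ΣD-const zero    c = refl
  ΣD-const (suc n) c = begin
    ΣD {suc n} (λ _ → c)                         ≡⟨ ΣD-suc {n} _ ⟩
    ΣV {n} (λ _ → c) + ΣD {n} (λ _ → c)          ≡⟨ cong₂ _+_ (ΣV-const n c) (ΣD-const n c) ⟩
    pos (q ℕ.^ n) * c + pos (gauss1 q n) * c     ≡⟨ sym (ℤP.*-distribʳ-+ c (pos (q ℕ.^ n)) (pos (gauss1 q n))) ⟩
    pos (gauss1 q (suc n)) * c                   ∎

  ΣK-translate : ∀ a (h : K → ℤ) → ΣK (λ t → h (a ⊕ t)) ≡ ΣK h
  ΣK-translate a h = ΣKP.∑-reindex (a ⊕_) (⊖ a ⊕_)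
    (𝕂P.\\-leftDividesˡ a) (𝕂P.\\-leftDividesʳ a) h

  ΣV-translateˡ : ∀ w (h : V n → ℤ) → ΣV (λ v → h (w ⊞ v)) ≡ ΣV h
  ΣV-translateˡ w h = ΣVP.∑-reindex (w ⊞_) (⊟ w ⊞_)
    (𝕍P.\\-leftDividesˡ w) (𝕍P.\\-leftDividesʳ w) h

  ΣV-translateʳ : ∀ w (h : V n → ℤ) → ΣV (λ v → h (v ⊞ w)) ≡ ΣV h
  ΣV-translateʳ w h = trans (∑-cong (vectors _) (λ v → cong h (𝕍.comm v w))) (ΣV-translateˡ w h)

  ΣV-scale : ∀ t → t ≢ 𝟘 → (h : V n → ℤ) → ΣV (λ v → h (t · v)) ≡ ΣV h
  ΣV-scale t t≢𝟘 h = ΣVP.∑-reindex (t ·_) (s ·_)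
    (λ v → trans (sym (·-assoc t s v)) (trans (cong (_· v) ts≡𝟙) (·-identity v)))
    (λ v → trans (sym (·-assoc s t v)) (trans (cong (_· v) (trans (𝕂.*-comm s t) ts≡𝟙)) (·-identity v))) h
    where
    s     = proj₁ (reciprocal t t≢𝟘)
    ts≡𝟙 = proj₂ (reciprocal t t≢𝟘)

  -- A nonzero vector is t · vec d for exactly one pair (t , d), while 𝟎 arises once for each d.
  polar : (h : V n → ℤ) →
    ΣD (λ d → ΣK (λ t → h (t · vec d))) + h 𝟎 ≡ ΣV h + pos (gauss1 q n) * h 𝟎
  polar {zero}  h = base (h [])
    where
    base : ∀ x → 0ℤ + x ≡ x + 0ℤ + 0ℤ * x
    base = solve-∀
  polar {suc n} h = begin
    ΣD (λ d → ΣK (λ t → h (t · vec d))) + h 𝟎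
      ≡⟨ cong (_+ h 𝟎) (ΣD-suc {n} _) ⟩
    ΣV (λ v → ΣK (λ t → h (t ⊗ 𝟙 ∷ t · v))) + ΣD (λ d → ΣK (λ t → h (t ⊗ 𝟘 ∷ t · vec d))) + h 𝟎
      ≡⟨ cong (_+ h 𝟎) (cong₂ _+_ unit-part zero-part) ⟩
    ΣK a + D + h 𝟎
      ≡⟨ ℤP.+-assoc (ΣK a) D _ ⟩
    ΣK a + (D + h 𝟎)
      ≡⟨ cong (ΣK a +_) (polar (λ v → h (𝟘 ∷ v))) ⟩
    ΣK a + (b 𝟘 + g * h 𝟎)
      ≡⟨ sym (ℤP.+-assoc (ΣK a) _ _) ⟩
    ΣK a + b 𝟘 + g * h 𝟎
      -- For `t ≢ 𝟘` scaling by `t` permutes the vectors, so `a` and `b` differ only at `𝟘`, where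
      -- `a` repeats `h 𝟎` once for every vector.
      ≡⟨ cong (_+ g * h 𝟎) (ΣKP.∑-exchange-at 𝟘 a b (λ t t≢𝟘 → ΣV-scale t t≢𝟘 (λ v → h (t ∷ v)))) ⟩
    ΣK b + a 𝟘 + g * h 𝟎
      ≡⟨ cong (λ s → ΣK b + s + g * h 𝟎) a𝟘 ⟩
    ΣK b + pos (q ℕ.^ n) * h 𝟎 + g * h 𝟎
      ≡⟨ collect (ΣK b) (pos (q ℕ.^ n)) g (h 𝟎) ⟩
    ΣK b + (pos (q ℕ.^ n) + g) * h 𝟎
      ≡⟨ cong (_+ pos (gauss1 q (suc n)) * h 𝟎) (sym (ΣV-suc h)) ⟩
    ΣV h + pos (gauss1 q (suc n)) * h 𝟎 ∎
    where
    g = pos (gauss1 q n)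
    a b : K → ℤ
    a t = ΣV (λ v → h (t ∷ t · v))
    b t = ΣV (λ v → h (t ∷ v))
    D = ΣD (λ d → ΣK (λ t → h (𝟘 ∷ t · vec d)))
    unit-part : ΣV (λ v → ΣK (λ t → h (t ⊗ 𝟙 ∷ t · v))) ≡ ΣK a
    unit-part = trans (∑-comm _ (vectors n) (allFin q))
      (∑-cong (allFin q) (λ t → ∑-cong (vectors n) (λ v → cong (λ s → h (s ∷ t · v)) (𝕂.*-identityʳ t))))
    zero-part : ΣD (λ d → ΣK (λ t → h (t ⊗ 𝟘 ∷ t · vec d))) ≡ D
    zero-part = ∑-cong (directions n) (λ d → ∑-cong (allFin q) (λ t → cong (λ s → h (s ∷ t · vec d)) (𝕂.zeroʳ t)))
    a𝟘 : a 𝟘 ≡ pos (q ℕ.^ n) * h 𝟎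
    a𝟘 = trans (∑-cong (vectors n) (λ v → cong (λ w → h (𝟘 ∷ w)) (·-zeroˡ v))) (ΣV-const n (h 𝟎))
    collect : ∀ x y z w → x + y * w + z * w ≡ x + (y + z) * w
    collect = solve-∀

-- Lines and spreads

module Lines {q : ℕ} (F : FiniteField q) (n : ℕ) where
  open FiniteField F
  open Coordinates F
  open AG F n
  private module R = CommutativeRing ring

  toVec : Point → V n
  toVec X = Vec.tabulate (index ∘ X)

  lookup-toVec : ∀ X j → enum (Vec.lookup (toVec X) j) R.≈ X j
  lookup-toVec X j = R.trans (R.reflexive (cong enum (VecP.lookup∘tabulate (index ∘ X) j))) (enum-index (X j))

  line : V n → Dir n → Sub 1
  line v d = record
    { base  = λ j → enum (Vec.lookup v j)
    ; dir   = λ _ j → enum (Vec.lookup (vec d) j)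
    -- The pivot entry of `vec d` is 1, so the equation at the pivot says that the coefficient
    -- vanishes.
    ; indep = λ { a e zero → R.trans (lead (a zero)) (e (pivot d)) } }
    where
    lead : ∀ s → s R.≈ s R.* enum (coord d (vec d)) R.+ R.0#
    lead s = R.sym (R.trans (R.+-identityʳ _) (R.trans
      (R.*-congˡ (R.trans (R.reflexive (cong enum (coord-vec d))) (enum-index R.1#))) (R.*-identityʳ s)))

  private
    enum-lookup : ∀ (v w : V n) s j →
      enum (Vec.lookup (v ⊞ s · w) j) R.≈
      enum (Vec.lookup v j) R.+ (enum s R.* enum (Vec.lookup w j) R.+ R.0#)
    enum-lookup v w s j = R.trans
      (R.reflexive (cong enum (trans (VecP.lookup-zipWith _⊕_ j v (s · w))
        (cong (Vec.lookup v j ⊕_) (VecP.lookup-map j (s ⊗_) w)))))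
      (R.trans (enum-index _) (R.+-congˡ (R.trans (enum-index _) (R.sym (R.+-identityʳ _)))))

  ∈line⁺ : ∀ {X v d} t → toVec X ≡ v ⊞ t · vec d → X ∈S line v d
  ∈line⁺ {X} {v} {d} t e = (λ _ → enum t) , λ j →
    R.trans (R.sym (lookup-toVec X j))
      (R.trans (R.reflexive (cong (λ u → enum (Vec.lookup u j)) e)) (enum-lookup v (vec d) t j))

  ∈line⁻ : ∀ {X v d} → X ∈S line v d → ∃ λ t → toVec X ≡ v ⊞ t · vec d
  ∈line⁻ {X} {v} {d} (a , e) = t , trans (VecP.tabulate-cong pointwise) (VecP.tabulate∘lookup _)
    where
    t = index (a zero)
    pointwise : ∀ j → index (X j) ≡ Vec.lookup (v ⊞ t · vec d) j
    pointwise j = enum-inj _ _ (R.trans (enum-index (X j)) (R.trans (e j) (R.trans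
      (R.+-congˡ (R.+-congʳ (R.*-congʳ (R.sym (enum-index (a zero))))))
      (R.sym (enum-lookup v (vec d) t j)))))

  line-shift : ∀ v d t → SameSub (line (v ⊞ t · vec d) d) (line v d)
  line-shift v d t X = forward , backward
    where
    forward : X ∈S line (v ⊞ t · vec d) d → X ∈S line v d
    forward X∈ with ∈line⁻ X∈
    ... | s , e = ∈line⁺ (t ⊕ s) (trans e (⊞-·-merge v t s (vec d)))
    backward : X ∈S line v d → X ∈S line (v ⊞ t · vec d) d
    backward X∈ with ∈line⁻ X∈
    ... | s , e = ∈line⁺ (⊖ t ⊕ s) (trans e (begin
      v ⊞ s · vec d                              ≡⟨ cong (_⊞ s · vec d) (sym (⊞-·-cancelˡ v t (vec d))) ⟩
      v ⊞ t · vec d ⊞ (⊖ t) · vec d ⊞ s · vec d  ≡⟨ ⊞-·-merge _ (⊖ t) s (vec d) ⟩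
      v ⊞ t · vec d ⊞ (⊖ t ⊕ s) · vec d          ∎))

  -- Cameron-Liebler sets of lines

  module LineSet (L : Sub 1 → Bool) (wd : WellDefined L) (x : ℕ) (cl : IsCameronLiebler L x) where

    -- Lines are indexed by a base point and a direction, so each line occurs once for each of its
    -- `q` points. This is the origin of the factor `pos q` in `Σ-field`.
    f : V n → Dir n → ℤ
    f v d = bit (L (line v d))

    f-shift : ∀ v d t → f (v ⊞ t · vec d) d ≡ f v d
    f-shift v d t = cong bit (wd _ _ (line-shift v d t))

    -- The lines v + ⟨φ v⟩ partition the space; each of them is represented by its
    -- unique point whose coordinate at the pivot of the direction vanishes.
    module DirectionField (φ : V n → Dir n) (φ-const : ∀ v t → φ (v ⊞ t · vec (φ v)) ≡ φ v) where

      Root : V n → Set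
      Root v = coord (φ v) v ≡ 𝟘

      root? : Decidable Root
      root? v = coord (φ v) v FinP.≟ 𝟘

      roots : List (V n)
      roots = filter root? (vectors n)

      roots-unique : Unique roots
      roots-unique = UniqueP.filter⁺ root? (vectors-unique n)

      slide : V n → K → V n
      slide v t = v ⊞ t · vec (φ v)

      coord-slide : ∀ v t → coord (φ (slide v t)) (slide v t) ≡ coord (φ v) v ⊕ t
      coord-slide v t = trans (cong (λ d → coord d (slide v t)) (φ-const v t)) (coord-⊞-·vec (φ v) v t)

      slide-slide : ∀ v s t → slide (slide v s) t ≡ v ⊞ s · vec (φ v) ⊞ t · vec (φ v)
      slide-slide v s t = cong (λ d → slide v s ⊞ t · vec d) (φ-const v s)

      spread : Fin (length roots) → Sub 1
      spread i = line (lookup roots i) (φ (lookup roots i))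

      -- The pivot coordinate is 0 at a root and grows with the parameter. Hence a point determines
      -- the direction and the parameter by which it is reached from a root, which makes the lines
      -- of the spread disjoint.
      root-coord : ∀ {r v t} → r ∈ roots → v ≡ slide r t → φ v ≡ φ r × coord (φ v) v ≡ t
      root-coord {r} {t = t} r∈ refl = φ-const r t ,
        trans (coord-slide r t)
          (trans (cong (_⊕ t) (proj₂ (∈P.∈-filter⁻ root? {xs = vectors n} r∈))) (𝕂.+-identityˡ t))

      root-unique : ∀ {r r′ v t t′} → r ∈ roots → r′ ∈ roots → v ≡ slide r t → v ≡ slide r′ t′ → r ≡ r′
      root-unique {r} {r′} {v} {t} {t′} r∈ r′∈ e e′ = 𝕍P.∙-cancelʳ (t · vec (φ r)) r r′ (begin
        slide r t          ≡⟨ sym e ⟩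
        v                  ≡⟨ e′ ⟩
        r′ ⊞ t′ · vec (φ r′)
          ≡⟨ cong₂ (λ s d → r′ ⊞ s · vec d) (trans (sym (proj₂ c′)) (proj₂ c)) (trans (sym (proj₁ c′)) (proj₁ c)) ⟩
        r′ ⊞ t · vec (φ r) ∎)
        where
        c  = root-coord r∈ e
        c′ = root-coord r′∈ e′

      isSpread : IsSpread spread
      isSpread X = covered , disjoint
        where
        v = toVec X
        t = coord (φ v) v
        -- Sliding back by the pivot coordinate leads to the root of the line through `v`.
        r = slide v (⊖ t)
        r∈ : r ∈ roots
        r∈ = ∈P.∈-filter⁺ root? (vectors-complete r) (trans (coord-slide v (⊖ t)) (𝕂.-‿inverseʳ t))
        covered : ∃ λ i → X ∈S spread i
        covered = Any.index r∈ , subst (λ w → X ∈S line w (φ w)) (AnyP.lookup-index r∈)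
          (∈line⁺ t (sym (trans (slide-slide v (⊖ t) t) (⊞-·-cancelʳ v t (vec (φ v))))))
        disjoint : ∀ i j → X ∈S spread i → X ∈S spread j → i ≡ j
        disjoint i j X∈i X∈j = lookup-injective roots-unique i j
          (root-unique (∈P.∈-lookup i) (∈P.∈-lookup j) (proj₂ (∈line⁻ X∈i)) (proj₂ (∈line⁻ X∈j)))

      h : V n → ℤ
      h v = f v (φ v)

      h-slide : ∀ v t → h (slide v t) ≡ h v
      h-slide v t = trans (cong (f (slide v t)) (φ-const v t)) (f-shift v (φ v) t)

      Σ-roots : ΣV (λ v → [ root? v ] * h v) ≡ pos x
      Σ-roots = begin
        ΣV (λ v → [ root? v ] * h v) ≡⟨ sym (∑-filter root? h (vectors n)) ⟩
        ∑ roots h                    ≡⟨ sym (countTrue-lookup (λ v → L (line v (φ v))) roots) ⟩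
        pos (countTrue (length roots) (L ∘ spread)) ≡⟨ cong pos (cl _ spread isSpread) ⟩
        pos x ∎

      Σ-slide : ∀ t (k : V n → ℤ) → ΣV (λ v → k (slide v t)) ≡ ΣV k
      Σ-slide t = ΣVP.∑-reindex (λ v → slide v t) (λ v → slide v (⊖ t))
        (λ v → trans (slide-slide v (⊖ t) t) (⊞-·-cancelʳ v t _))
        (λ v → trans (slide-slide v t (⊖ t)) (⊞-·-cancelˡ v t _))

      -- Along the line through `v` the pivot coordinate is `coord (φ v) v ⊕ t`, which vanishes for
      -- exactly one `t`.
      one-root : ∀ v → ΣK (λ t → [ root? (slide v t) ]) ≡ 1ℤ
      one-root v = trans
        (∑-cong (allFin q) (λ t → []-⇔ (root? (slide v t)) (t FinP.≟ ⊖ coord (φ v) v)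
          (λ e → 𝕂P.+-cancelˡ (coord (φ v) v) t _ (trans (sym (coord-slide v t)) (trans e (sym (𝕂.-‿inverseʳ _)))))
          (λ e → trans (coord-slide v t) (trans (cong (coord (φ v) v ⊕_) e) (𝕂.-‿inverseʳ _)))))
        (ΣKP.∑-δ-1 _)

      -- Each term is multiplied by the number 1 of roots on its line. For each of the `q`
      -- parameters, the slide is a bijection that turns the sum into the sum over the roots, and
      -- this is `x` by the Cameron-Liebler condition.
      Σ-field : ΣV h ≡ pos q * pos x
      Σ-field = begin
        ΣV h
          ≡⟨ ∑-cong (vectors n) (λ v → trans (sym (ℤP.*-identityˡ (h v))) (trans (cong (_* h v) (sym (one-root v)))
               (sym (∑-distribʳ-* (h v) _ (allFin q))))) ⟩
        ΣV (λ v → ΣK (λ t → [ root? (slide v t) ] * h v))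
          ≡⟨ ∑-comm _ (vectors n) (allFin q) ⟩
        ΣK (λ t → ΣV (λ v → [ root? (slide v t) ] * h v))
          ≡⟨ ∑-cong (allFin q) (λ t → ∑-cong (vectors n) (λ v → cong ([ root? (slide v t) ] *_) (sym (h-slide v t)))) ⟩
        ΣK (λ t → ΣV (λ v → [ root? (slide v t) ] * h (slide v t)))
          ≡⟨ ∑-cong (allFin q) (λ t → trans (Σ-slide t (λ v → [ root? v ] * h v)) Σ-roots) ⟩
        ΣK (λ t → pos x)
          ≡⟨ ΣK-const (pos x) ⟩
        pos q * pos x ∎

    Σ-parallel : ∀ d → ΣV (λ v → f v d) ≡ pos q * pos x
    Σ-parallel d = DirectionField.Σ-field (λ _ → d) (λ _ _ → refl)

    -- Switching a parallel class inside one plane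

    module Plane (p : V n) (d e : Dir n) where
      point : K → K → V n
      point s t = p ⊞ s · vec d ⊞ t · vec e

      On : V n → Set
      On v = ∃₂ λ s t → v ≡ point s t

      on? : Decidable On
      on? v = FinP.any? λ s → FinP.any? λ t → Finite._≟_ (V-finite n) v (point s t)

      point-⊞ : ∀ s t s′ t′ → point s t ⊞ s′ · vec d ⊞ t′ · vec e ≡ point (s ⊕ s′) (t ⊕ t′)
      point-⊞ s t s′ t′ = begin
        p ⊞ s · vec d ⊞ t · vec e ⊞ s′ · vec d ⊞ t′ · vec e
          ≡⟨ cong (_⊞ t′ · vec e) (⊞-swap (p ⊞ s · vec d) (t · vec e) (s′ · vec d)) ⟩
        p ⊞ s · vec d ⊞ s′ · vec d ⊞ t · vec e ⊞ t′ · vec e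
          ≡⟨ ⊞-·-merge _ t t′ (vec e) ⟩
        p ⊞ s · vec d ⊞ s′ · vec d ⊞ (t ⊕ t′) · vec e
          ≡⟨ cong (_⊞ (t ⊕ t′) · vec e) (⊞-·-merge p s s′ (vec d)) ⟩
        point (s ⊕ s′) (t ⊕ t′) ∎

      on-e : ∀ {v} t → On v → On (v ⊞ t · vec e)
      on-e t (s₀ , t₀ , refl) = s₀ , t₀ ⊕ t , ⊞-·-merge _ t₀ t (vec e)

      on-d : ∀ {v} s → On v → On (v ⊞ s · vec d)
      on-d s (s₀ , t₀ , refl) = s₀ ⊕ s , t₀ ,
        trans (⊞-swap _ (t₀ · vec e) (s · vec d)) (cong (_⊞ t₀ · vec e) (⊞-·-merge p s₀ s (vec d)))

      φ : V n → Dir n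
      φ v = if does (on? v) then e else d

      φ-on : ∀ v → On v → φ v ≡ e
      φ-on v o with on? v
      ... | yes _ = refl
      ... | no ¬o = contradiction o ¬o

      φ-off : ∀ v → ¬ On v → φ v ≡ d
      φ-off v ¬o with on? v
      ... | yes o = contradiction o ¬o
      ... | no _  = refl

      -- The plane is closed under translation along both `d` and `e`, so it is a union of lines
      -- with direction `e` and its complement is a union of lines with direction `d`.
      φ-const : ∀ v t → φ (v ⊞ t · vec (φ v)) ≡ φ v
      φ-const v t with on? v
      ... | yes o = φ-on _ (on-e t o)
      ... | no ¬o = φ-off _ (λ o → ¬o (subst On (⊞-·-cancelˡ v t (vec d)) (on-d (⊖ t) o)))

      Δ : V n → ℤ
      Δ v = f v e - f v d

      -- The spread given by `φ` and the parallel class of `d` contain equally many lines of `L`,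
      -- and they can differ only inside the plane.
      Σ-on : ΣV (λ v → [ on? v ] * Δ v) ≡ 0ℤ
      Σ-on = begin
        ΣV (λ v → [ on? v ] * Δ v)
          ≡⟨ ∑-cong (vectors n) switch ⟩
        ΣV (λ v → f v (φ v) - f v d)
          ≡⟨ ∑-distrib-- _ _ (vectors n) ⟩
        ΣV (λ v → f v (φ v)) - ΣV (λ v → f v d)
          ≡⟨ cong₂ _-_ (DirectionField.Σ-field φ φ-const) (Σ-parallel d) ⟩
        pos q * pos x - pos q * pos x
          ≡⟨ ℤP.+-inverseʳ (pos q * pos x) ⟩
        0ℤ ∎
        where
        switch : ∀ v → [ on? v ] * Δ v ≡ f v (φ v) - f v d
        switch v with on? v
        ... | yes _ = ℤP.*-identityˡ _
        ... | no  _ = sym (ℤP.+-inverseʳ (f v d))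

      -- Every point of the plane has the same number of representations point s t, which is
      -- 1 unless d ≡ e; working with the multiplicity avoids this case distinction.
      private
        _≟_ = Finite._≟_ (V-finite n)

        multiplicity : V n → ℤ
        multiplicity v = ΣK (λ s → ΣK (λ t → [ v ≟ point s t ]))

        -- Translating the parameters by `s₀` and `t₀` matches the representations of `p` with those
        -- of `point s₀ t₀`.
        multiplicity-on : ∀ s₀ t₀ → multiplicity (point s₀ t₀) ≡ multiplicity p
        multiplicity-on s₀ t₀ = begin
          ΣK (λ s → ΣK (λ t → [ point s₀ t₀ ≟ point s t ]))
            ≡⟨ sym (ΣK-translate s₀ _) ⟩
          ΣK (λ s → ΣK (λ t → [ point s₀ t₀ ≟ point (s₀ ⊕ s) t ]))
            ≡⟨ ∑-cong (allFin q) (λ s → sym (ΣK-translate t₀ _)) ⟩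
          ΣK (λ s → ΣK (λ t → [ point s₀ t₀ ≟ point (s₀ ⊕ s) (t₀ ⊕ t) ]))
            ≡⟨ ∑-cong (allFin q) (λ s → ∑-cong (allFin q) (λ t →
                 []-⇔ (point s₀ t₀ ≟ point (s₀ ⊕ s) (t₀ ⊕ t)) (p ≟ point s t) (to s t) (from s t))) ⟩
          multiplicity p ∎
          where
          shift : V n → V n
          shift v = v ⊞ s₀ · vec d ⊞ t₀ · vec e
          shift-point : ∀ s t → shift (point s t) ≡ point (s₀ ⊕ s) (t₀ ⊕ t)
          shift-point s t = trans (point-⊞ s t s₀ t₀) (cong₂ point (𝕂.+-comm s s₀) (𝕂.+-comm t t₀))
          to : ∀ s t → point s₀ t₀ ≡ point (s₀ ⊕ s) (t₀ ⊕ t) → p ≡ point s t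
          to s t eq = 𝕍P.∙-cancelʳ _ _ _ (𝕍P.∙-cancelʳ _ _ _ (trans eq (sym (shift-point s t))))
          from : ∀ s t → p ≡ point s t → point s₀ t₀ ≡ point (s₀ ⊕ s) (t₀ ⊕ t)
          from s t eq = trans (cong shift eq) (shift-point s t)

        multiplicity-≡ : ∀ v → multiplicity v ≡ multiplicity p * [ on? v ]
        multiplicity-≡ v with on? v
        ... | yes (s₀ , t₀ , refl) = trans (multiplicity-on s₀ t₀) (sym (ℤP.*-identityʳ _))
        ... | no ¬o = trans
          (∑-cong (allFin q) (λ s → trans (∑-cong (allFin q) (λ t → []-no (v ≟ point s t) (λ eq → ¬o (s , t , eq)))) (∑-zero (allFin q))))
          (trans (∑-zero (allFin q)) (sym (ℤP.*-zeroʳ (multiplicity p))))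

      Σ-points : (h : V n → ℤ) → ΣK (λ s → ΣK (λ t → h (point s t))) ≡ multiplicity p * ΣV (λ v → [ on? v ] * h v)
      Σ-points h = begin
        ΣK (λ s → ΣK (λ t → h (point s t)))
          ≡⟨ ∑-cong (allFin q) (λ s → ∑-cong (allFin q) (λ t → sym (ΣVP.∑-δ h (point s t)))) ⟩
        ΣK (λ s → ΣK (λ t → ΣV (λ v → [ v ≟ point s t ] * h v)))
          ≡⟨ ∑-cong (allFin q) (λ s → ∑-comm _ (allFin q) (vectors n)) ⟩
        ΣK (λ s → ΣV (λ v → ΣK (λ t → [ v ≟ point s t ] * h v)))
          ≡⟨ ∑-comm _ (allFin q) (vectors n) ⟩
        ΣV (λ v → ΣK (λ s → ΣK (λ t → [ v ≟ point s t ] * h v)))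
          ≡⟨ ∑-cong (vectors n) (λ v → trans (∑-cong (allFin q) (λ s → ∑-distribʳ-* (h v) _ (allFin q)))
               (∑-distribʳ-* (h v) _ (allFin q))) ⟩
        ΣV (λ v → multiplicity v * h v)
          ≡⟨ ∑-cong (vectors n) (λ v → trans (cong (_* h v) (multiplicity-≡ v)) (ℤP.*-assoc (multiplicity p) _ (h v))) ⟩
        ΣV (λ v → multiplicity p * ([ on? v ] * h v))
          ≡⟨ ∑-distribˡ-* (multiplicity p) _ (vectors n) ⟩
        multiplicity p * ΣV (λ v → [ on? v ] * h v) ∎

      Σ-Δ : ΣK (λ s → ΣK (λ t → Δ (point s t))) ≡ 0ℤ
      Σ-Δ = trans (Σ-points Δ) (trans (cong (multiplicity p *_) Σ-on) (ℤP.*-zeroʳ (multiplicity p)))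

      f-point-e : ∀ s t → f (point s t) e ≡ f (p ⊞ s · vec d) e
      f-point-e s t = f-shift (p ⊞ s · vec d) e t

      f-point-d : ∀ s t → f (point s t) d ≡ f (p ⊞ t · vec e) d
      f-point-d s t = trans (cong (λ v → f v d) (⊞-swap p _ _)) (f-shift (p ⊞ t · vec e) d s)

      -- On `point s t`, the value of `f` in direction `e` depends only on `s`, and that in
      -- direction `d` only on `t`. Summing over the other parameter gives the factor `pos q`.
      q-exchange : pos q * ΣK (λ s → f (p ⊞ s · vec d) e) - pos q * ΣK (λ t → f (p ⊞ t · vec e) d) ≡ 0ℤ
      q-exchange = begin
        pos q * ΣK a - pos q * ΣK b
          ≡⟨ cong₂ _-_ (sym (∑-distribˡ-* (pos q) a (allFin q))) (sym (ΣK-const (ΣK b))) ⟩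
        ΣK (λ s → pos q * a s) - ΣK (λ s → ΣK b)
          ≡⟨ cong (_- ΣK (λ s → ΣK b)) (∑-cong (allFin q) (λ s → sym (ΣK-const (a s)))) ⟩
        ΣK (λ s → ΣK (λ t → a s)) - ΣK (λ s → ΣK b)
          ≡⟨ sym (∑-distrib-- _ _ (allFin q)) ⟩
        ΣK (λ s → ΣK (λ t → a s) - ΣK b)
          ≡⟨ ∑-cong (allFin q) (λ s → trans (sym (∑-distrib-- _ _ (allFin q)))
               (∑-cong (allFin q) (λ t → cong₂ _-_ (sym (f-point-e s t)) (sym (f-point-d s t))))) ⟩
        ΣK (λ s → ΣK (λ t → Δ (point s t)))
          ≡⟨ Σ-Δ ⟩
        0ℤ ∎
        where
        a b : K → ℤ
        a s = f (p ⊞ s · vec d) e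
        b t = f (p ⊞ t · vec e) d

    -- For `d ≢ e` the two sides count the lines of `L` in the plane with direction `d` and with
    -- direction `e`, each line through its point on the other axis through `p`.
    plane-regular : ∀ p d e → ΣK (λ t → f (p ⊞ t · vec e) d) ≡ ΣK (λ t → f (p ⊞ t · vec d) e)
    plane-regular p d e = sym (ℤP.*-cancelˡ-≡ (pos q) _ _ (ℤP.i-j≡0⇒i≡j _ _ (Plane.q-exchange p d e)))
      where instance
        q≢0 : ℕ.NonZero q
        q≢0 = FinP.nonZeroIndex 𝟘

-- Weights

gauss1-suc : ∀ q n → gauss1 q (suc n) ≡ suc (q ℕ.* gauss1 q n)
gauss1-suc q zero    = cong suc (sym (ℕP.*-zeroʳ q))
gauss1-suc q (suc n) = begin
  q ℕ.* q ℕ.^ n ℕ.+ gauss1 q (suc n)                 ≡⟨ cong (q ℕ.* q ℕ.^ n ℕ.+_) (gauss1-suc q n) ⟩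
  q ℕ.* q ℕ.^ n ℕ.+ suc (q ℕ.* gauss1 q n)           ≡⟨ collect q (q ℕ.^ n) (gauss1 q n) ⟩
  suc (q ℕ.* (q ℕ.^ n ℕ.+ gauss1 q n))               ∎
  where
  collect : ∀ a b c → a ℕ.* b ℕ.+ suc (a ℕ.* c) ≡ suc (a ℕ.* (b ℕ.+ c))
  collect = ℕSolver.solve-∀

-- Consecutive powers pair up: q^(2j+1) + q^(2j) = (q+1) q^(2j).
q+1∣gauss1-even : ∀ q j → q ℕ.+ 1 ℕ∣.∣ gauss1 q (j ℕ.+ j)
q+1∣gauss1-even q zero    = (q ℕ.+ 1) ℕ∣.∣0
q+1∣gauss1-even q (suc j) = subst (λ i → q ℕ.+ 1 ℕ∣.∣ gauss1 q (suc i)) (sym (ℕP.+-suc j j))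
  (subst (q ℕ.+ 1 ℕ∣.∣_) (collect q (q ℕ.^ (j ℕ.+ j)) (gauss1 q (j ℕ.+ j)))
    (ℕ∣.∣m∣n⇒∣m+n (ℕ∣.m∣m*n (q ℕ.^ (j ℕ.+ j))) (q+1∣gauss1-even q j)))
  where
  collect : ∀ a b c → (a ℕ.+ 1) ℕ.* b ℕ.+ c ≡ a ℕ.* b ℕ.+ (b ℕ.+ c)
  collect = ℕSolver.solve-∀

module Weights {q : ℕ} (F : FiniteField q) (m : ℕ)
  (f : Coordinates.V F (suc (suc m)) → Coordinates.Dir F (suc (suc m)) → ℤ)
  (x : ℕ) where

  open Coordinates F

  private
    n : ℕ
    n = suc (suc m)

    Q X G : ℤ
    Q = pos q
    X = pos x
    G = Q * pos (gauss1 q (suc m))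

  g≡1+G : pos (gauss1 q n) ≡ 1ℤ + G
  g≡1+G = begin
    pos (gauss1 q n)                       ≡⟨ cong pos (gauss1-suc q (suc m)) ⟩
    1ℤ + pos (q ℕ.* gauss1 q (suc m))      ≡⟨ cong (1ℤ +_) (ℤP.pos-* q _) ⟩
    1ℤ + G                                 ∎

  instance
    q-nonZero : ℕ.NonZero q
    q-nonZero = FinP.nonZeroIndex 𝟘

    G-nonZero : ℤ.NonZero G
    G-nonZero = ℤP.i*j≢0 Q (pos (gauss1 q (suc m))) {{q-nonZero}}
      {{ℕ.>-nonZero (ℕP.≤-trans (ℕP.m^n>0 q m) (ℕP.m≤m+n _ (gauss1 q m)))}}

  module _
    (f-idem : ∀ v d → f v d * f v d ≡ f v d)
    (f-shift : ∀ v d t → f (v ⊞ t · vec d) d ≡ f v d)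
    (Σ-parallel : ∀ d → ΣV (λ v → f v d) ≡ Q * X)
    (plane-regular : ∀ p d e → ΣK (λ t → f (p ⊞ t · vec e) d) ≡ ΣK (λ t → f (p ⊞ t · vec d) e))
    where

    -- This is `polar` with the origin moved to `p`: the lines on `p` cover every other point once
    -- and `p` once per direction, that is `1 + G` times.
    polar-at : ∀ p (h : V n → ℤ) →
      ΣD (λ d → ΣK (λ t → h (p ⊞ t · vec d))) ≡ ΣV h + G * h p
    polar-at p h = ℤ+.∙-cancelʳ (h p) _ _ (begin
      ΣD (λ d → ΣK (λ t → h (p ⊞ t · vec d))) + h p
        ≡⟨ cong (λ v → ΣD (λ d → ΣK (λ t → h (p ⊞ t · vec d))) + h v) (sym (𝕍.identityʳ p)) ⟩
      ΣD (λ d → ΣK (λ t → h (p ⊞ t · vec d))) + h (p ⊞ 𝟎)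
        ≡⟨ polar (λ v → h (p ⊞ v)) ⟩
      ΣV (λ v → h (p ⊞ v)) + pos (gauss1 q n) * h (p ⊞ 𝟎)
        ≡⟨ cong₂ (λ s v → s + pos (gauss1 q n) * h v) (ΣV-translateˡ p h) (𝕍.identityʳ p) ⟩
      ΣV h + pos (gauss1 q n) * h p
        ≡⟨ cong (λ g → ΣV h + g * h p) g≡1+G ⟩
      ΣV h + (1ℤ + G) * h p
        ≡⟨ collect (ΣV h) G (h p) ⟩
      ΣV h + G * h p + h p ∎)
      where
      collect : ∀ a b c → a + (1ℤ + b) * c ≡ a + b * c + c
      collect = solve-∀

    excess : V n → ℤ
    excess p = ΣD (f p) - X

    -- By `plane-regular`, summing `f` in direction `d` along `e` may be replaced by summing `f` in
    -- direction `e` along `d`. Over all `d` the latter runs through all lines on `p`, and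
    -- `polar-at` evaluates the total.
    Σ-excess-line : ∀ p e → ΣK (λ t → excess (p ⊞ t · vec e)) ≡ G * f p e
    Σ-excess-line p e = begin
      ΣK (λ t → ΣD (f (p ⊞ t · vec e)) - X)
        ≡⟨ ∑-distrib-- _ _ (allFin q) ⟩
      ΣK (λ t → ΣD (f (p ⊞ t · vec e))) - ΣK (λ t → X)
        ≡⟨ cong₂ _-_ (∑-comm _ (allFin q) (directions n)) (ΣK-const X) ⟩
      ΣD (λ d → ΣK (λ t → f (p ⊞ t · vec e) d)) - Q * X
        ≡⟨ cong (_- Q * X) (∑-cong (directions n) (λ d → plane-regular p d e)) ⟩
      ΣD (λ d → ΣK (λ t → f (p ⊞ t · vec d) e)) - Q * X
        ≡⟨ cong (_- Q * X) (polar-at p (λ v → f v e)) ⟩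
      ΣV (λ v → f v e) + G * f p e - Q * X
        ≡⟨ cong (λ s → s + G * f p e - Q * X) (Σ-parallel e) ⟩
      Q * X + G * f p e - Q * X
        ≡⟨ cancel (Q * X) (G * f p e) ⟩
      G * f p e ∎
      where
      cancel : ∀ a b → a + b - a ≡ b
      cancel = solve-∀

    embed : V 2 → V n
    embed (a ∷ b ∷ []) = a ∷ b ∷ 𝟎

    -- Padding with zeros keeps the first nonzero entry 1, so the directions of the coordinate plane
    -- remain normalised.
    embedDir : Dir 2 → Dir n
    embedDir (inj₁ (b ∷ []))  = inj₁ (b ∷ 𝟎)
    embedDir (inj₂ (inj₁ [])) = inj₂ (inj₁ 𝟎)

    embed-·vec : ∀ t d → embed (t · vec d) ≡ t · vec (embedDir d)
    embed-·vec t (inj₁ (b ∷ []))  = cong (λ v → t ⊗ 𝟙 ∷ t ⊗ b ∷ v) (sym (·-zeroʳ t))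
    embed-·vec t (inj₂ (inj₁ [])) = cong (λ v → t ⊗ 𝟘 ∷ t ⊗ 𝟙 ∷ v) (sym (·-zeroʳ t))

    d₁ d₂ : Dir n
    d₁ = inj₁ (𝟘 ∷ 𝟎)
    d₂ = inj₂ (inj₁ 𝟎)

    embed-basis : ∀ a b → embed (a ∷ b ∷ []) ≡ a · vec d₁ ⊞ b · vec d₂
    embed-basis a b = cong₂ _∷_
      (sym (trans (cong₂ _⊕_ (𝕂.*-identityʳ a) (𝕂.zeroʳ b)) (𝕂.+-identityʳ a)))
      (cong₂ _∷_
        (sym (trans (cong₂ _⊕_ (𝕂.zeroʳ a) (𝕂.*-identityʳ b)) (𝕂.+-identityˡ b)))
        (sym (trans (cong₂ _⊞_ (·-zeroʳ a) (·-zeroʳ b)) (𝕍.identityˡ 𝟎))))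

    -- An explicitly integral form of `q` times the weight `excess p / G`: in the plane through `p`
    -- spanned by `d₁` and `d₂`, the number of lines of `L` on `p` minus the number of those with
    -- direction `d₂`.
    u : V n → ℤ
    u p = ΣD (λ d → f p (embedDir d)) - ΣK (λ a → f (p ⊞ a · vec d₁) d₂)

    -- The sum of the excess over the plane p + ⟨vec d₁ , vec d₂⟩ is computed in two ways: by the
    -- lines through p, which count p itself q + 1 times, and by the lines parallel to d₂.
    G*u : ∀ p → G * u p ≡ Q * excess p
    G*u p = begin
      G * (star - cross)                       ≡⟨ expand G star cross (c p) ⟩
      (G * star + c p) - (G * cross + c p)     ≡⟨ cong (_- (G * cross + c p)) planar ⟩
      (G * cross + (Q * 1ℤ + 1ℤ) * c p) - (G * cross + c p) ≡⟨ cancel (G * cross) Q (c p) ⟩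
      Q * c p ∎
      where
      c = excess
      star = ΣD (λ d → f p (embedDir d))
      cross = ΣK (λ a → f (p ⊞ a · vec d₁) d₂)
      h : V 2 → ℤ
      h v = c (p ⊞ embed v)
      h𝟎 : h 𝟎 ≡ c p
      h𝟎 = cong c (𝕍.identityʳ p)
      directions-part : ΣD (λ d → ΣK (λ t → h (t · vec d))) ≡ G * star
      directions-part = trans
        (∑-cong (directions 2) (λ d → trans
          (∑-cong (allFin q) (λ t → cong (λ v → c (p ⊞ v)) (embed-·vec t d)))
          (Σ-excess-line p (embedDir d))))
        (∑-distribˡ-* G _ (directions 2))
      points-part : ΣV h ≡ G * cross
      points-part = begin
        ΣV h
          ≡⟨ ΣV-suc h ⟩
        ΣK (λ a → ΣV (λ v → h (a ∷ v)))
          ≡⟨ ∑-cong (allFin q) (λ a → trans (ΣV-suc (λ v → h (a ∷ v)))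
               (∑-cong (allFin q) (λ b → ℤP.+-identityʳ _))) ⟩
        ΣK (λ a → ΣK (λ b → h (a ∷ b ∷ [])))
          ≡⟨ ∑-cong (allFin q) (λ a → ∑-cong (allFin q) (λ b → cong c
               (trans (cong (p ⊞_) (embed-basis a b)) (sym (𝕍.assoc p _ _))))) ⟩
        ΣK (λ a → ΣK (λ b → c (p ⊞ a · vec d₁ ⊞ b · vec d₂)))
          ≡⟨ ∑-cong (allFin q) (λ a → Σ-excess-line (p ⊞ a · vec d₁) d₂) ⟩
        ΣK (λ a → G * f (p ⊞ a · vec d₁) d₂)
          ≡⟨ ∑-distribˡ-* G _ (allFin q) ⟩
        G * cross ∎
      planar : G * star + c p ≡ G * cross + (Q * 1ℤ + 1ℤ) * c p
      planar = begin
        G * star + c p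
          ≡⟨ cong₂ _+_ (sym directions-part) (sym h𝟎) ⟩
        ΣD (λ d → ΣK (λ t → h (t · vec d))) + h 𝟎
          ≡⟨ polar h ⟩
        -- The coefficient is what `gauss1 q 2` computes to, the number of directions in a plane.
        ΣV h + (pos (q ℕ.* 1) + 1ℤ) * h 𝟎
          ≡⟨ cong₂ (λ s t → s + (pos (q ℕ.* 1) + 1ℤ) * t) points-part h𝟎 ⟩
        G * cross + (pos (q ℕ.* 1) + 1ℤ) * c p
          ≡⟨ cong (λ s → G * cross + (s + 1ℤ) * c p) (ℤP.pos-* q 1) ⟩
        G * cross + (Q * 1ℤ + 1ℤ) * c p ∎
      expand : ∀ g a b c → g * (a - b) ≡ (g * a + c) - (g * b + c)
      expand = solve-∀
      cancel : ∀ b q c → (b + (q * 1ℤ + 1ℤ) * c) - (b + c) ≡ q * c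
      cancel = solve-∀

    Σ-u-line : ∀ p e → ΣK (λ t → u (p ⊞ t · vec e)) ≡ Q * f p e
    Σ-u-line p e = ℤP.*-cancelˡ-≡ G _ _ (begin
      G * ΣK (λ t → u (p ⊞ t · vec e))
        ≡⟨ sym (∑-distribˡ-* G _ (allFin q)) ⟩
      ΣK (λ t → G * u (p ⊞ t · vec e))
        ≡⟨ ∑-cong (allFin q) (λ t → G*u (p ⊞ t · vec e)) ⟩
      ΣK (λ t → Q * excess (p ⊞ t · vec e))
        ≡⟨ ∑-distribˡ-* Q _ (allFin q) ⟩
      Q * ΣK (λ t → excess (p ⊞ t · vec e))
        ≡⟨ cong (Q *_) (Σ-excess-line p e) ⟩
      Q * (G * f p e)
        ≡⟨ *-swap Q G (f p e) ⟩
      G * (Q * f p e) ∎)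

    -- Translation by each of the `q` multiples of `vec e` leaves the sum over the space unchanged.
    average : ∀ e (h : V n → ℤ) → Q * ΣV h ≡ ΣV (λ v → ΣK (λ t → h (v ⊞ t · vec e)))
    average e h = begin
      Q * ΣV h                                      ≡⟨ sym (ΣK-const (ΣV h)) ⟩
      ΣK (λ t → ΣV h)                               ≡⟨ ∑-cong (allFin q) (λ t → sym (ΣV-translateʳ (t · vec e) h)) ⟩
      ΣK (λ t → ΣV (λ v → h (v ⊞ t · vec e)))       ≡⟨ ∑-comm _ (allFin q) (vectors n) ⟩
      ΣV (λ v → ΣK (λ t → h (v ⊞ t · vec e)))       ∎

    Σ-u : ΣV u ≡ Q * X
    Σ-u = ℤP.*-cancelˡ-≡ Q _ _ (begin
      Q * ΣV u                                      ≡⟨ average d₁ u ⟩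
      ΣV (λ v → ΣK (λ t → u (v ⊞ t · vec d₁)))      ≡⟨ ∑-cong (vectors n) (λ v → Σ-u-line v d₁) ⟩
      ΣV (λ v → Q * f v d₁)                         ≡⟨ ∑-distribˡ-* Q _ (vectors n) ⟩
      Q * ΣV (λ v → f v d₁)                         ≡⟨ cong (Q *_) (Σ-parallel d₁) ⟩
      Q * (Q * X)                                   ∎)

    -- On a line with direction `e` the factor `f` is constant and `u` sums to `Q * f`, so the line
    -- contributes `Q * f` again because `f` is idempotent.
    Σ-f*u : ∀ e → ΣV (λ v → f v e * u v) ≡ Q * X
    Σ-f*u e = ℤP.*-cancelˡ-≡ Q _ _ (begin
      Q * ΣV (λ v → f v e * u v)
        ≡⟨ average e (λ v → f v e * u v) ⟩
      ΣV (λ v → ΣK (λ t → f (v ⊞ t · vec e) e * u (v ⊞ t · vec e)))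
        ≡⟨ ∑-cong (vectors n) (λ v → trans
             (∑-cong (allFin q) (λ t → cong (_* u (v ⊞ t · vec e)) (f-shift v e t)))
             (∑-distribˡ-* (f v e) _ (allFin q))) ⟩
      ΣV (λ v → f v e * ΣK (λ t → u (v ⊞ t · vec e)))
        ≡⟨ ∑-cong (vectors n) (λ v → trans (cong (f v e *_) (Σ-u-line v e))
             (trans (*-swap (f v e) Q (f v e)) (cong (Q *_) (f-idem v e)))) ⟩
      ΣV (λ v → Q * f v e)
        ≡⟨ ∑-distribˡ-* Q _ (vectors n) ⟩
      Q * ΣV (λ v → f v e)
        ≡⟨ cong (Q *_) (Σ-parallel e) ⟩
      Q * (Q * X) ∎)

    -- The sum of `Q * (f v e * u v)` over all points and directions is taken first by directions,
    -- using `Σ-f*u`, and then by points, where `Q * f v e` is expanded as a line sum of `u` and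
    -- `polar-at` applies.
    double-count : pos (gauss1 q n) * (Q * (Q * X)) ≡ Q * X * (Q * X) + G * ΣV (λ v → u v * u v)
    double-count = begin
      pos (gauss1 q n) * (Q * (Q * X))
        ≡⟨ sym (ΣD-const n _) ⟩
      ΣD {n} (λ e → Q * (Q * X))
        ≡⟨ ∑-cong (directions n) (λ e → trans (cong (Q *_) (sym (Σ-f*u e))) (sym (∑-distribˡ-* Q _ (vectors n)))) ⟩
      ΣD {n} (λ e → ΣV (λ v → Q * (f v e * u v)))
        ≡⟨ ∑-comm _ (directions n) (vectors n) ⟩
      ΣV (λ v → ΣD (λ e → Q * (f v e * u v)))
        ≡⟨ ∑-cong (vectors n) (λ v → trans
             (∑-cong (directions n) (λ e → trans (sym (ℤP.*-assoc Q (f v e) (u v))) (cong (_* u v) (sym (Σ-u-line v e)))))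
             (∑-distribʳ-* (u v) _ (directions n))) ⟩
      ΣV (λ v → ΣD (λ e → ΣK (λ t → u (v ⊞ t · vec e))) * u v)
        ≡⟨ ∑-cong (vectors n) (λ v → trans
             (cong (_* u v) (trans (polar-at v u) (cong (_+ G * u v) Σ-u)))
             (expand (Q * X) G (u v))) ⟩
      ΣV (λ v → Q * X * u v + G * (u v * u v))
        ≡⟨ ∑-distrib-+ _ _ (vectors n) ⟩
      ΣV (λ v → Q * X * u v) + ΣV (λ v → G * (u v * u v))
        ≡⟨ cong₂ _+_ (∑-distribˡ-* (Q * X) u (vectors n)) (∑-distribˡ-* G _ (vectors n)) ⟩
      Q * X * ΣV u + G * ΣV (λ v → u v * u v)
        ≡⟨ cong (λ s → Q * X * s + G * ΣV (λ v → u v * u v)) Σ-u ⟩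
      Q * X * (Q * X) + G * ΣV (λ v → u v * u v) ∎
      where
      expand : ∀ a b c → (a + b * c) * c ≡ a * c + b * (c * c)
      expand = solve-∀

    -- Rewrites `double-count` by expressing the sum of squares through `Σ-u`. One factor `Q` is
    -- cancelled against `G`, which leaves `gauss1 q (suc m)`.
    quadratic-identity : Q * (X * (X - 1ℤ)) ≡ pos (gauss1 q (suc m)) * ΣV (λ v → u v * (Q - u v))
    quadratic-identity = ℤP.*-cancelˡ-≡ Q _ _ (begin
      Q * (Q * (X * (X - 1ℤ)))
        ≡⟨ expand Q X G ⟩
      Q * X * (Q * X) - (1ℤ + G) * (Q * (Q * X)) + G * (Q * (Q * X))
        ≡⟨ cong (λ s → Q * X * (Q * X) - s + G * (Q * (Q * X))) (trans (cong (_* (Q * (Q * X))) (sym g≡1+G)) double-count) ⟩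
      Q * X * (Q * X) - (Q * X * (Q * X) + G * S) + G * (Q * (Q * X))
        ≡⟨ contract (Q * X * (Q * X)) Q g′ S (Q * (Q * X)) ⟩
      Q * (g′ * (Q * (Q * X) - S))
        ≡⟨ cong (λ s → Q * (g′ * s)) (sym Σ-u[Q-u]) ⟩
      Q * (g′ * ΣV (λ v → u v * (Q - u v))) ∎)
      where
      g′ = pos (gauss1 q (suc m))
      S = ΣV (λ v → u v * u v)
      Σ-u[Q-u] : ΣV (λ v → u v * (Q - u v)) ≡ Q * (Q * X) - S
      Σ-u[Q-u] = begin
        ΣV (λ v → u v * (Q - u v))
          ≡⟨ ∑-cong (vectors n) (λ v → distrib (u v) Q) ⟩
        ΣV (λ v → Q * u v - u v * u v)
          ≡⟨ ∑-distrib-- _ _ (vectors n) ⟩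
        ΣV (λ v → Q * u v) - S
          ≡⟨ cong (_- S) (trans (∑-distribˡ-* Q u (vectors n)) (cong (Q *_) Σ-u)) ⟩
        Q * (Q * X) - S ∎
        where
        distrib : ∀ a b → a * (b - a) ≡ b * a - a * a
        distrib = solve-∀
      expand : ∀ q x g → q * (q * (x * (x - 1ℤ))) ≡ q * x * (q * x) - (1ℤ + g) * (q * (q * x)) + g * (q * (q * x))
      expand = solve-∀
      contract : ∀ a q g s b → a - (a + q * g * s) + q * g * b ≡ q * (g * (b - s))
      contract = solve-∀

-- Arithmetic

parity : ∀ n → ∃ λ r → n ≡ r ℕ.+ r ⊎ n ≡ suc (r ℕ.+ r)
parity zero    = 0 , inj₁ refl
parity (suc n) with parity n
... | r , inj₁ e = r , inj₂ (cong suc e)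
... | r , inj₂ e = suc r , inj₁ (cong suc (trans e (sym (ℕP.+-suc r r))))

-- The binomial coefficient "n choose 2".
triangle : ℕ → ℕ
triangle zero    = 0
triangle (suc n) = n ℕ.+ triangle n

n*[n∸1]≡2*triangle : ∀ n → n ℕ.* (n ℕ.∸ 1) ≡ 2 ℕ.* triangle n
n*[n∸1]≡2*triangle zero          = refl
n*[n∸1]≡2*triangle (suc zero)    = refl
n*[n∸1]≡2*triangle (suc (suc n)) = begin
  suc (suc n) ℕ.* suc n                          ≡⟨ step n ⟩
  2 ℕ.* suc n ℕ.+ suc n ℕ.* n                    ≡⟨ cong (2 ℕ.* suc n ℕ.+_) (n*[n∸1]≡2*triangle (suc n)) ⟩
  2 ℕ.* suc n ℕ.+ 2 ℕ.* triangle (suc n)         ≡⟨ sym (ℕP.*-distribˡ-+ 2 (suc n) _) ⟩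
  2 ℕ.* triangle (suc (suc n))                   ∎
  where
  step : ∀ n → suc (suc n) ℕ.* suc n ≡ 2 ℕ.* suc n ℕ.+ suc n ℕ.* n
  step = ℕSolver.solve-∀

n*[n-1]≡2*triangle : ∀ n → pos n * (pos n - 1ℤ) ≡ pos 2 * pos (triangle n)
n*[n-1]≡2*triangle zero    = refl
n*[n-1]≡2*triangle (suc n) = begin
  pos (suc n) * pos n              ≡⟨ sym (ℤP.pos-* (suc n) n) ⟩
  pos (suc n ℕ.* n)                ≡⟨ cong pos (n*[n∸1]≡2*triangle (suc n)) ⟩
  pos (2 ℕ.* triangle (suc n))     ≡⟨ ℤP.pos-* 2 (triangle (suc n)) ⟩
  pos 2 * pos (triangle (suc n))   ∎

-- The product i (i - 1) is invariant under i ↦ 1 - i, which sends -(n + 1) to n + 2.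
triangleℤ : ℤ → ℤ
triangleℤ (pos n)      = pos (triangle n)
triangleℤ (ℤ.-[1+ n ]) = pos (triangle (suc (suc n)))

i*[i-1]≡2*triangle : ∀ i → i * (i - 1ℤ) ≡ pos 2 * triangleℤ i
i*[i-1]≡2*triangle (pos n)      = n*[n-1]≡2*triangle n
i*[i-1]≡2*triangle (ℤ.-[1+ n ]) = trans (reflect (pos (suc n))) (n*[n-1]≡2*triangle (suc (suc n)))
  where
  reflect : ∀ a → (- a) * ((- a) - 1ℤ) ≡ (1ℤ + a) * ((1ℤ + a) - 1ℤ)
  reflect = solve-∀

-- For q = 2r + 1 the product is 2ri - i (i - 1), a difference of two even numbers.
odd-form : ∀ r i → i * (pos (suc (r ℕ.+ r)) - i) ≡ pos 2 * (pos r * i - triangleℤ i)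
odd-form r i = begin
  i * (1ℤ + (pos r + pos r) - i)            ≡⟨ split i (pos r) ⟩
  pos 2 * (pos r * i) - i * (i - 1ℤ)        ≡⟨ cong (λ s → pos 2 * (pos r * i) - s) (i*[i-1]≡2*triangle i) ⟩
  pos 2 * (pos r * i) - pos 2 * triangleℤ i ≡⟨ collect (pos 2) (pos r * i) (triangleℤ i) ⟩
  pos 2 * (pos r * i - triangleℤ i)         ∎
  where
  split : ∀ i r → i * (1ℤ + (r + r) - i) ≡ pos 2 * (r * i) - i * (i - 1ℤ)
  split = solve-∀
  collect : ∀ a b c → a * b - a * c ≡ a * (b - c)
  collect = solve-∀

coprime-q+1-q : ∀ q → Coprime (q ℕ.+ 1) q
coprime-q+1-q q (i∣q+1 , i∣q) = ℕ∣.∣1⇒≡1 (ℕ∣.∣m+n∣m⇒∣n i∣q+1 i∣q)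

coprime-q+1-2 : ∀ r → Coprime (r ℕ.+ r ℕ.+ 1) 2
coprime-q+1-2 r {i} (i∣q+1 , i∣2) = ℕ∣.∣1⇒≡1 (ℕ∣.∣m+n∣m⇒∣n i∣q+1
  (subst (i ℕ∣.∣_) (cong (r ℕ.+_) (ℕP.+-identityʳ r)) (ℕ∣.∣m⇒∣m*n {m = 2} r i∣2)))

-- The cofactor `i` may be negative; absolute values bring the equation back to natural numbers.
∣-from-ℤ : ∀ {k g y} (i : ℤ) → k ℕ∣.∣ g → pos y ≡ pos g * i → k ℕ∣.∣ y
∣-from-ℤ {k} {g} {y} i k∣g e =
  subst (k ℕ∣.∣_) (sym (trans (cong ℤ.∣_∣ e) (ℤP.abs-* (pos g) i))) (ℕ∣.∣m⇒∣m*n ℤ.∣ i ∣ k∣g)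

-- Divisibility for sets of lines

module LineSets {q : ℕ} (F : FiniteField q) (m : ℕ)
  (L : AG.Sub F (suc (suc m)) 1 → Bool) (wd : AG.WellDefined F (suc (suc m)) L)
  (x : ℕ) (cl : AG.IsCameronLiebler F (suc (suc m)) L x) where

  open Coordinates F
  open Lines F (suc (suc m))
  open LineSet L wd x cl
  open Weights F m f x

  private
    f-idem : ∀ v d → f v d * f v d ≡ f v d
    f-idem v d = bit-idem (L (line v d))

    w : V (suc (suc m)) → ℤ
    w = u f-idem f-shift Σ-parallel plane-regular

    g : ℤ
    g = pos (gauss1 q (suc m))

  triangle-identity : pos 2 * (pos q * pos (triangle x)) ≡ g * ΣV (λ v → w v * (pos q - w v))
  triangle-identity = begin
    pos 2 * (pos q * pos (triangle x))      ≡⟨ *-swap (pos 2) (pos q) _ ⟩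
    pos q * (pos 2 * pos (triangle x))      ≡⟨ cong (pos q *_) (sym (n*[n-1]≡2*triangle x)) ⟩
    pos q * (pos x * (pos x - 1ℤ))          ≡⟨ quadratic-identity f-idem f-shift Σ-parallel plane-regular ⟩
    g * ΣV (λ v → w v * (pos q - w v))      ∎

  -- For even `q`, both 2 and `q` are coprime to q + 1 and cancel from the left side of
  -- `triangle-identity`. For odd `q`, q + 1 is even, so the factor 2 is instead divided out of
  -- every summand on the right by `odd-form`.
  q+1∣triangle : q ℕ.+ 1 ℕ∣.∣ gauss1 q (suc m) → q ℕ.+ 1 ℕ∣.∣ triangle x
  q+1∣triangle q+1∣g with parity q
  ... | r , inj₁ q-even = Coprimality.coprime-divisor (coprime-q+1-q q)
    (Coprimality.coprime-divisor coprime-2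
      (∣-from-ℤ _ q+1∣g (trans pos-2qt triangle-identity)))
    where
    coprime-2 : Coprime (q ℕ.+ 1) 2
    coprime-2 = subst (λ q → Coprime (q ℕ.+ 1) 2) (sym q-even) (coprime-q+1-2 r)
    pos-2qt : pos (2 ℕ.* (q ℕ.* triangle x)) ≡ pos 2 * (pos q * pos (triangle x))
    pos-2qt = trans (ℤP.pos-* 2 (q ℕ.* triangle x)) (cong (pos 2 *_) (ℤP.pos-* q (triangle x)))
  ... | r , inj₂ q-odd = Coprimality.coprime-divisor (coprime-q+1-q q)
    (∣-from-ℤ {y = q ℕ.* triangle x} half q+1∣g (ℤP.*-cancelˡ-≡ (pos 2) _ _ (begin
      pos 2 * pos (q ℕ.* triangle x)
        ≡⟨ cong (pos 2 *_) (ℤP.pos-* q (triangle x)) ⟩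
      pos 2 * (pos q * pos (triangle x))
        ≡⟨ triangle-identity ⟩
      g * ΣV (λ v → w v * (pos q - w v))
        ≡⟨ cong (g *_) (∑-cong (vectors _) (λ v → trans (cong (λ q → w v * (pos q - w v)) q-odd) (odd-form r (w v)))) ⟩
      g * ΣV (λ v → pos 2 * (pos r * w v - triangleℤ (w v)))
        ≡⟨ cong (g *_) (∑-distribˡ-* (pos 2) _ (vectors (suc (suc m)))) ⟩
      g * (pos 2 * half)
        ≡⟨ *-swap g (pos 2) half ⟩
      pos 2 * (g * half) ∎)))
    where
    half : ℤ
    half = ΣV (λ v → pos r * w v - triangleℤ (w v))

  -- One of `m` and `suc m` is even. In the first case q + 1 divides the factor `gauss1 q m` itself,
  -- in the second it divides `gauss1 q (suc m)` and therefore `triangle x`.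
  q+1∣triangle*gauss1 : q ℕ.+ 1 ℕ∣.∣ triangle x ℕ.* gauss1 q m
  q+1∣triangle*gauss1 with parity m
  ... | j , inj₁ refl = ℕ∣.∣n⇒∣m*n (triangle x) (q+1∣gauss1-even q j)
  ... | j , inj₂ refl = ℕ∣.∣m⇒∣m*n (gauss1 q m)
    (q+1∣triangle (subst (λ i → q ℕ.+ 1 ℕ∣.∣ gauss1 q i) (cong suc (ℕP.+-suc j j)) (q+1∣gauss1-even q (suc j))))

  divisibility : 2 ℕ.* (q ℕ.+ 1) ℕ∣.∣ x ℕ.* (x ℕ.∸ 1) ℕ.* gauss1 q m
  divisibility = subst (2 ℕ.* (q ℕ.+ 1) ℕ∣.∣_)
    (trans (sym (ℕP.*-assoc 2 (triangle x) _)) (cong (ℕ._* gauss1 q m) (sym (n*[n∸1]≡2*triangle x))))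
    (ℕ∣.*-monoʳ-∣ 2 q+1∣triangle*gauss1)

-- Cylinders

module Cylinder {q : ℕ} (F : FiniteField q) (n : ℕ) where
  open FiniteField F
  open CommutativeRing ring hiding (zero)
    renaming (_+_ to _+ᶠ_; _*_ to _*ᶠ_; refl to ≈-refl; sym to ≈-sym; trans to ≈-trans)
  private
    module Small = AG F n
    module Big   = AG F (suc n)

  lift : ∀ {k} → (Fin k → Small.Point) → Fin k → Big.Point
  lift v i = 0# ◂ v i

  axis : Big.Point
  axis = 1# ◂ λ _ → 0#

  lincomb-lift-zero : ∀ {k} (a : Fin k → Carrier) v → Big.lincomb a (lift v) zero ≈ 0#
  lincomb-lift-zero {zero}  a v = ≈-refl
  lincomb-lift-zero {suc k} a v =
    ≈-trans (+-cong (zeroʳ (a zero)) (lincomb-lift-zero (a ∘ suc) (v ∘ suc))) (+-identityˡ 0#)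

  lincomb-lift-suc : ∀ {k} (a : Fin k → Carrier) v j → Big.lincomb a (lift v) (suc j) ≡ Small.lincomb a v j
  lincomb-lift-suc {zero}  a v j = refl
  lincomb-lift-suc {suc k} a v j = cong (a zero *ᶠ v zero j +ᶠ_) (lincomb-lift-suc (a ∘ suc) (v ∘ suc) j)

  lincomb-zero : ∀ {k} (a : Fin (suc k) → Carrier) v → Big.lincomb a (axis ◂ lift v) zero ≈ a zero
  lincomb-zero a v =
    ≈-trans (+-cong (*-identityʳ (a zero)) (lincomb-lift-zero (a ∘ suc) v)) (+-identityʳ (a zero))

  lincomb-suc : ∀ {k} (a : Fin (suc k) → Carrier) v j →
    Big.lincomb a (axis ◂ lift v) (suc j) ≈ Small.lincomb (a ∘ suc) v j
  lincomb-suc a v j =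
    ≈-trans (+-cong (zeroʳ (a zero)) (reflexive (lincomb-lift-suc (a ∘ suc) v j))) (+-identityˡ _)

  -- The preimage of `U` under the projection that forgets the first coordinate.
  cylinder : ∀ {k} → Small.Sub k → Big.Sub (suc k)
  cylinder U = record
    { base  = 0# ◂ base
    ; dir   = axis ◂ lift dir
    ; indep = λ
      { a e zero    → ≈-trans (≈-sym (lincomb-zero a dir)) (e zero)
      ; a e (suc i) → indep (a ∘ suc) (λ j → ≈-trans (≈-sym (lincomb-suc a dir j)) (e (suc j))) i } }
    where open Small.Sub U

  ∈-cylinder⁻ : ∀ {k X} {U : Small.Sub k} → X Big.∈S cylinder U → (X ∘ suc) Small.∈S U
  ∈-cylinder⁻ {U = U} (a , e) =
    a ∘ suc , λ j → ≈-trans (e (suc j)) (+-congˡ (lincomb-suc a (Small.Sub.dir U) j))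

  ∈-cylinder⁺ : ∀ {k X} {U : Small.Sub k} → (X ∘ suc) Small.∈S U → X Big.∈S cylinder U
  -- The base has first coordinate 0 and only `axis` contributes to it, so the coefficient of `axis`
  -- is `X zero`.
  ∈-cylinder⁺ {X = X} {U} (a , e) = X zero ◂ a , λ
    { zero    → ≈-sym (≈-trans (+-identityˡ _) (lincomb-zero (X zero ◂ a) dir))
    ; (suc j) → ≈-trans (e j) (+-congˡ (≈-sym (lincomb-suc (X zero ◂ a) dir j))) }
    where open Small.Sub U

  cylinder-cong : ∀ {k} (U W : Small.Sub k) → Small.SameSub U W → Big.SameSub (cylinder U) (cylinder W)
  cylinder-cong U W same X =
    (λ X∈ → ∈-cylinder⁺ {U = W} (proj₁ (same (X ∘ suc)) (∈-cylinder⁻ {U = U} X∈))) ,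
    (λ X∈ → ∈-cylinder⁺ {U = U} (proj₂ (same (X ∘ suc)) (∈-cylinder⁻ {U = W} X∈)))

  -- Preimages of the parts of a partition partition the domain of the projection.
  cylinder-spread : ∀ {k m} (S : Fin m → Small.Sub k) → Small.IsSpread S → Big.IsSpread (cylinder ∘ S)
  cylinder-spread S spread X =
    (proj₁ covered , ∈-cylinder⁺ {U = S _} (proj₂ covered)) ,
    λ i j X∈i X∈j → proj₂ (spread (X ∘ suc)) i j (∈-cylinder⁻ {U = S i} X∈i) (∈-cylinder⁻ {U = S j} X∈j)
    where covered = proj₁ (spread (X ∘ suc))

-- Pulling `L` back along `cylinder` lowers the dimensions of the subspaces and of the space by 1
-- and preserves the parameter and the codimension `suc m`. The induction ends at lines.
cylinder-reduction : ∀ {q} (F : FiniteField q) k m (L : AG.Sub F (k ℕ.+ suc (suc m)) (suc k) → Bool) →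
  AG.WellDefined F (k ℕ.+ suc (suc m)) L → ∀ x → AG.IsCameronLiebler F (k ℕ.+ suc (suc m)) L x →
  2 ℕ.* (q ℕ.+ 1) ℕ∣.∣ x ℕ.* (x ℕ.∸ 1) ℕ.* gauss1 q m
cylinder-reduction F zero    m L wd x cl = LineSets.divisibility F m L wd x cl
cylinder-reduction F (suc k) m L wd x cl =
  cylinder-reduction F k m (L ∘ cylinder) (λ U W same → wd _ _ (cylinder-cong U W same)) x
    (λ l S spread → cl l (cylinder ∘ S) (cylinder-spread S spread))
  where open Cylinder F (k ℕ.+ suc (suc m))

theorem3p4 : ∀ {q : ℕ} → IsPrimePower q → (F : FiniteField q) →
    (k n : ℕ) → 1 ℕ.< k → k ℕ.+ 5 ℕ.≤ n →
    (L : AG.Sub F n k → Bool) → AG.WellDefined F n L →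
    (x : ℕ) → AG.IsCameronLiebler F n L x →
    (2 ℕ.* (q ℕ.+ 1)) ℕ∣.∣ (x ℕ.* (x ℕ.∸ 1) ℕ.* gauss1 q (n ℕ.∸ k ℕ.∸ 1))
theorem3p4 {q} _ F (suc k) n _ k+5≤n L wd x cl with ℕP.m≤n⇒∃[o]m+o≡n k+5≤n
-- Here n = `suc k` + 5 + o, so the lines reached by the reduction lie in dimension 6 + o, and m = n
-- - `suc k` - 1 = 4 + o.
... | o , refl = subst (λ m → 2 ℕ.* (q ℕ.+ 1) ℕ∣.∣ x ℕ.* (x ℕ.∸ 1) ℕ.* gauss1 q m) (sym codim) (reduced _ (n≡ k o) L wd cl)
  where
  n≡ : ∀ k o → suc k ℕ.+ 5 ℕ.+ o ≡ k ℕ.+ suc (suc (4 ℕ.+ o))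
  n≡ = ℕSolver.solve-∀
  -- The dimension is abstracted to a variable, so that matching on the equation transports `L` and
  -- its properties.
  reduced : ∀ n → n ≡ k ℕ.+ suc (suc (4 ℕ.+ o)) → (L : AG.Sub F n (suc k) → Bool) → AG.WellDefined F n L →
    AG.IsCameronLiebler F n L x → 2 ℕ.* (q ℕ.+ 1) ℕ∣.∣ x ℕ.* (x ℕ.∸ 1) ℕ.* gauss1 q (4 ℕ.+ o)
  reduced n refl L wd = cylinder-reduction F k (4 ℕ.+ o) L wd x
  codim : suc k ℕ.+ 5 ℕ.+ o ℕ.∸ suc k ℕ.∸ 1 ≡ 4 ℕ.+ o
  codim = cong (ℕ._∸ 1) (trans (cong (ℕ._∸ suc k) (ℕP.+-assoc (suc k) 5 o)) (ℕP.m+n∸m≡n (suc k) (5 ℕ.+ o)))
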